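{- For every automorphism-free tree $T$, $E_7$ can be obtained from $T$ by successively deleting a leaf at a time in such a way that each intermediate tree is also automorphism-free.
   Context: All graphs are finite and simple. A tree $T$ with $|V(T)|\ge 2$ is automorphism-free if it has no automorphism other than the identity (an automorphism being a bijection of the vertex set preserving adjacency and non-adjacency). $E_7$ is the tree on 7 vertices consisting of a vertex $c$ of degree three together with three paths attached at $c$ having $1$, $2$ and $3$ vertices respectively (i.e. the spider with legs of lengths $1,2,3$). -}

module Defs where

open import Data.Nat using (ℕ; zero; suc; _≤_)
open import Data.Fin using (Fin; toℕ; punchIn)
open import Data.Bool using (Bool; true; false; _∨_; _∧_)
open import Data.Bool.Properties using (∨-comm)
open import Data.Vec using (Vec; []; _∷_; lookup; head; last)
open import Data.Product using (Σ; _×_; _,_; ∃)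
open import Data.Empty using (⊥)
open import Function.Bundles using (_↔_; Inverse)
open import Relation.Binary.PropositionalEquality using (_≡_; refl)
import Data.Nat as ℕ

record Graph (n : ℕ) : Set where
  field
    adj    : Fin n → Fin n → Bool
    sym    : ∀ i j → adj i j ≡ adj j i
    irrefl : ∀ i → adj i i ≡ false
open Graph public

Adj : ∀ {n} → Graph n → Fin n → Fin n → Set
Adj G i j = adj G i j ≡ true

data Reach {n : ℕ} (G : Graph n) : Fin n → Fin n → Set where
  here : ∀ {i} → Reach G i i
  step : ∀ {i j k} → Adj G i j → Reach G j k → Reach G i k

Connected : ∀ {n} → Graph n → Set
Connected G = ∀ i j → Reach G i j

record Cycle {n : ℕ} (G : Graph n) : Set where
  field
    len      : ℕ
    verts    : Vec (Fin n) (suc (suc (suc len)))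
    distinct : ∀ a b → lookup verts a ≡ lookup verts b → a ≡ b
    consec   : ∀ (a : Fin (suc (suc len))) →
               Adj G (lookup verts (Data.Fin.inject₁ a)) (lookup verts (Data.Fin.suc a))
    closing  : Adj G (last verts) (head verts)

Acyclic : ∀ {n} → Graph n → Set
Acyclic G = Cycle G → ⊥

IsTree : ∀ {n} → Graph n → Set
IsTree {n} G = (1 ≤ n) × Connected G × Acyclic G

Isomorphism : ∀ {n} → Graph n → Graph n → Set
Isomorphism {n} G H =
  Σ (Fin n ↔ Fin n) λ f → ∀ i j → adj H (Inverse.to f i) (Inverse.to f j) ≡ adj G i j

Isomorphic : ∀ {n} → Graph n → Graph n → Set
Isomorphic G H = Isomorphism G H

Automorphism : ∀ {n} → Graph n → Set
Automorphism G = Isomorphism G G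

AutFree : ∀ {n} → Graph n → Set
AutFree {n} G = (2 ≤ n) × (∀ (φ : Automorphism G) → ∀ i → Inverse.to (Data.Product.proj₁ φ) i ≡ i)

Leaf : ∀ {n} → Graph n → Fin n → Set
Leaf {n} G v = Σ (Fin n) λ u → Adj G v u × (∀ w → Adj G v w → w ≡ u)

delete : ∀ {n} → Graph (suc n) → Fin (suc n) → Graph n
delete G v = record
  { adj    = λ i j → adj G (punchIn v i) (punchIn v j)
  ; sym    = λ i j → sym G (punchIn v i) (punchIn v j)
  ; irrefl = λ i → irrefl G (punchIn v i)
  }

data _⇝_ : ∀ {n m} → Graph n → Graph m → Set where
  done : ∀ {n} {G : Graph n} → G ⇝ G
  del  : ∀ {n m} {G : Graph (suc n)} {H : Graph m} (v : Fin (suc n)) →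
         Leaf G v → AutFree (delete G v) → delete G v ⇝ H → G ⇝ H

-- E₇: centre 0; legs 0-1 ; 0-2-3 ; 0-4-5-6.
e7edge : ℕ → ℕ → Bool
e7edge 0 1 = true
e7edge 0 2 = true
e7edge 2 3 = true
e7edge 0 4 = true
e7edge 4 5 = true
e7edge 5 6 = true
e7edge _ _ = false

e7adj : Fin 7 → Fin 7 → Bool
e7adj i j = e7edge (toℕ i) (toℕ j) ∨ e7edge (toℕ j) (toℕ i)

e7irrefl : ∀ i → e7adj i i ≡ false
e7irrefl Fin.zero = refl
e7irrefl (Fin.suc Fin.zero) = refl
e7irrefl (Fin.suc (Fin.suc Fin.zero)) = refl
e7irrefl (Fin.suc (Fin.suc (Fin.suc Fin.zero))) = refl
e7irrefl (Fin.suc (Fin.suc (Fin.suc (Fin.suc Fin.zero)))) = refl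
e7irrefl (Fin.suc (Fin.suc (Fin.suc (Fin.suc (Fin.suc Fin.zero))))) = refl
e7irrefl (Fin.suc (Fin.suc (Fin.suc (Fin.suc (Fin.suc (Fin.suc Fin.zero)))))) = refl

E7 : Graph 7
E7 = record
  { adj    = e7adj
  ; sym    = λ i j → ∨-comm (e7edge (toℕ i) (toℕ j)) (e7edge (toℕ j) (toℕ i))
  ; irrefl = e7irrefl
  }

{-# OPTIONS --safe #-}

-- Root the tree at a centroid and list the branches at every vertex by descending size (ties broken by
-- a total order); rigidity makes all these lists strict, and conversely a strictly sorted tree has no
-- automorphism fixing its root. Deleting a leaf from a smallest branch, recursively, keeps the lists
-- strict. Let a be the largest branch, r the rest including the root.
-- If |a| + 2 ≤ |r|, delete from r: the root stays the only centroid, hence is fixed.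
-- If |a| = |r|, delete from a or from r; both fail only if r = prune a ▷ • and a = prune r ▷ •, which
-- forces a = r by descent. The case |r| = |a| + 1 with r = x ▷ • is similar.
-- If |r| = |a| + 1 and the root has at least three branches, delete from a; this fails only if
-- r = prune a ▷ • ▷ •. Then delete the last branch •; this fails only if a = prune a ▷ •, where either the
-- tree is E₇ or a leaf of the middle branch can be deleted.
module Submission where

open import Defs hiding (sym)
open import Data.Nat using (ℕ; zero; suc; _+_; _≤_; _<_; _≤?_; z≤n; s≤s)
open import Data.Nat.Properties
  using (≤-refl; ≤-reflexive; ≤-trans; ≤-antisym; ≤-pred; ≰⇒>; <⇒≤; <-irrefl; <-trans; <-≤-trans; ≤-<-trans;
         <-cmp; n≤1+n; m≤m+n; m≤n⇒m≤n+o; m≤n⇒m<n∨m≡n; suc-injective; +-comm; +-suc; +-mono-≤; +-monoˡ-≤;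
         +-monoʳ-≤; +-monoʳ-<; +-mono-<-≤; +-cancelˡ-≡; +-cancelˡ-≤; +-cancelʳ-≤; module ≤-Reasoning)
open import Data.Bool as Bool using (Bool; true; false; _∧_)
open import Data.Bool.Properties using (∧-comm; ∧-zeroʳ; ∧-identityʳ; ⇔→≡)
open import Data.Fin using (Fin; zero; suc; toℕ; fromℕ; fromℕ<; inject₁; punchIn; punchOut; #_)
open import Data.Fin.Properties as Fin using (+↔⊎)
open import Data.Fin.Permutation using (↔⇒≡)
open import Data.Maybe as Maybe using (Maybe; just; nothing)
open import Data.Maybe.Properties using (just-injective)
open import Data.Vec as Vec using ()
open import Data.Vec.Properties using (lookup∘tabulate; lookup-map)
open import Data.Product using (Σ; ∃; _×_; _,_; proj₁; proj₂)
open import Data.Sum using (_⊎_; inj₁; inj₂)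
open import Data.Sum.Function.Propositional using (_⊎-↔_)
open import Data.Empty using (⊥-elim)
open import Data.Unit using (⊤; tt)
open import Function using (_∘_)
open import Function.Bundles using (_↔_; Inverse; Injection; mk↔ₛ′; mk⇔)
open import Function.Properties.Inverse using (↔-sym; ↔-trans; ↔⇒↣)
open import Function.Definitions using (Injective)
open import Relation.Nullary using (¬_; Dec; yes; no; ¬?; _×-dec_)
open import Relation.Nullary.Decidable using (decidable-stable; from-yes)
open import Relation.Binary.Definitions using (tri<; tri≈; tri>)
open import Relation.Binary.PropositionalEquality
  using (_≡_; _≢_; refl; sym; trans; cong; cong₂; subst; subst₂; module ≡-Reasoning)

-- Marked graphs, isomorphisms and rigidity

-- The marks make the root of a tree and the neighbours of a future leaf part of the structure.
record MarkedGraph : Set₁ where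
  field
    Vertex : Set
    edge   : Vertex → Vertex → Bool
    mark   : Vertex → Bool
open MarkedGraph

infix 4 _≅_
record _≅_ (G H : MarkedGraph) : Set where
  field
    to        : Vertex G → Vertex H
    from      : Vertex H → Vertex G
    to-from   : ∀ y → to (from y) ≡ y
    from-to   : ∀ x → from (to x) ≡ x
    edge-to   : ∀ x y → edge H (to x) (to y) ≡ edge G x y
    mark-to   : ∀ x → mark H (to x) ≡ mark G x

  to-injective : ∀ {x y} → to x ≡ to y → x ≡ y
  to-injective {x} {y} e = trans (sym (from-to x)) (trans (cong from e) (from-to y))
open _≅_

≅-refl : ∀ {G} → G ≅ G
≅-refl = record
  { to = λ x → x ; from = λ x → x ; to-from = λ _ → refl ; from-to = λ _ → refl
  ; edge-to = λ _ _ → refl ; mark-to = λ _ → refl }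

≅-sym : ∀ {G H} → G ≅ H → H ≅ G
≅-sym {G} {H} φ = record
  { to = from φ ; from = to φ ; to-from = from-to φ ; from-to = to-from φ
  ; edge-to = λ x y → trans (sym (edge-to φ _ _)) (cong₂ (edge H) (to-from φ x) (to-from φ y))
  ; mark-to = λ x → trans (sym (mark-to φ _)) (cong (mark H) (to-from φ x)) }

≅-trans : ∀ {G H K} → G ≅ H → H ≅ K → G ≅ K
≅-trans φ ψ = record
  { to = to ψ ∘ to φ ; from = from φ ∘ from ψ
  ; to-from = λ y → trans (cong (to ψ) (to-from φ _)) (to-from ψ y)
  ; from-to = λ x → trans (cong (from φ) (from-to ψ _)) (from-to φ x)
  ; edge-to = λ x y → trans (edge-to ψ _ _) (edge-to φ x y)
  ; mark-to = λ x → trans (mark-to ψ _) (mark-to φ x) }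

Rigid : MarkedGraph → Set
Rigid G = ∀ (φ : G ≅ G) x → to φ x ≡ x

Rigid-resp-≅ : ∀ {G H} → G ≅ H → Rigid G → Rigid H
Rigid-resp-≅ ψ rigid φ y = begin
  to φ y                                 ≡⟨ sym (to-from ψ _) ⟩
  to ψ (from ψ (to φ y))                 ≡⟨ cong (λ z → to ψ (from ψ (to φ z))) (sym (to-from ψ y)) ⟩
  to ψ (from ψ (to φ (to ψ (from ψ y)))) ≡⟨ cong (to ψ) (rigid (≅-trans ψ (≅-trans φ (≅-sym ψ))) (from ψ y)) ⟩
  to ψ (from ψ y)                        ≡⟨ to-from ψ y ⟩
  y ∎
  where open ≡-Reasoning

-- Rooted trees

-- a ▷ r is the rooted tree r with the tree a attached to its root as an additional first branch.
infixr 5 _▷_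
data Tree : Set where
  •   : Tree
  _▷_ : Tree → Tree → Tree

-- The vertices of a tree are the occurrences of `•` in its term; the rightmost one is the root.
data Pos : Tree → Set where
  pt  : Pos •
  inˡ : ∀ {a r} → Pos a → Pos (a ▷ r)
  inʳ : ∀ {a r} → Pos r → Pos (a ▷ r)

root : ∀ t → Pos t
root •       = pt
root (a ▷ r) = inʳ (root r)

isRoot : ∀ {t} → Pos t → Bool
isRoot pt      = true
isRoot (inˡ p) = false
isRoot (inʳ p) = isRoot p

adjacent : ∀ {t} → Pos t → Pos t → Bool
adjacent pt      pt      = false
adjacent (inˡ p) (inˡ q) = adjacent p q
adjacent (inˡ p) (inʳ q) = isRoot p ∧ isRoot q
-- The conjuncts are ordered so that exchanging the two vertices yields the same term.
adjacent (inʳ p) (inˡ q) = isRoot q ∧ isRoot p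
adjacent (inʳ p) (inʳ q) = adjacent p q

isRoot-root : ∀ t → isRoot (root t) ≡ true
isRoot-root •       = refl
isRoot-root (a ▷ r) = isRoot-root r

isRoot⇒≡root : ∀ {t} (p : Pos t) → isRoot p ≡ true → p ≡ root t
isRoot⇒≡root pt      e = refl
isRoot⇒≡root (inʳ p) e = cong inʳ (isRoot⇒≡root p e)

free : Tree → MarkedGraph
free t = record { Vertex = Pos t ; edge = adjacent ; mark = λ _ → false }

rooted : Tree → MarkedGraph
rooted t = record { Vertex = Pos t ; edge = adjacent ; mark = isRoot }

unroot : ∀ {s t} → rooted s ≅ rooted t → free s ≅ free t
unroot φ = record
  { to = to φ ; from = from φ ; to-from = to-from φ ; from-to = from-to φ
  ; edge-to = edge-to φ ; mark-to = λ _ → refl }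

to-root : ∀ {s t} (φ : rooted s ≅ rooted t) → to φ (root s) ≡ root t
to-root {s} φ = isRoot⇒≡root _ (trans (mark-to φ _) (isRoot-root s))

enroot : ∀ {s t} (φ : free s ≅ free t) → to φ (root s) ≡ root t → rooted s ≅ rooted t
enroot {s} {t} φ e = record
  { to = to φ ; from = from φ ; to-from = to-from φ ; from-to = from-to φ
  ; edge-to = edge-to φ ; mark-to = mark-φ }
  where
  mark-φ : ∀ p → isRoot (to φ p) ≡ isRoot p
  mark-φ p with isRoot p in eq | isRoot (to φ p) in eq′
  ... | true  | true  = refl
  ... | false | false = refl
  ... | true  | false = trans (sym eq′)
    (trans (cong (isRoot ∘ to φ) (isRoot⇒≡root p eq)) (trans (cong isRoot e) (isRoot-root t)))
  ... | false | true  = sym (trans (sym eq) (trans (cong isRoot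
    (to-injective φ (trans (isRoot⇒≡root (to φ p) eq′) (sym e)))) (isRoot-root s)))

free-rigid⇒rooted-rigid : ∀ {t} → Rigid (free t) → Rigid (rooted t)
free-rigid⇒rooted-rigid rigid φ = rigid (unroot φ)

▷-cong : ∀ {a b r s} → rooted a ≅ rooted b → rooted r ≅ rooted s → rooted (a ▷ r) ≅ rooted (b ▷ s)
▷-cong φ ψ = record
  { to = λ { (inˡ p) → inˡ (to φ p) ; (inʳ p) → inʳ (to ψ p) }
  ; from = λ { (inˡ p) → inˡ (from φ p) ; (inʳ p) → inʳ (from ψ p) }
  ; to-from = λ { (inˡ p) → cong inˡ (to-from φ p) ; (inʳ p) → cong inʳ (to-from ψ p) }
  ; from-to = λ { (inˡ p) → cong inˡ (from-to φ p) ; (inʳ p) → cong inʳ (from-to ψ p) }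
  ; edge-to = λ { (inˡ p) (inˡ q) → edge-to φ p q
                ; (inˡ p) (inʳ q) → cong₂ _∧_ (mark-to φ p) (mark-to ψ q)
                ; (inʳ p) (inˡ q) → cong₂ _∧_ (mark-to φ q) (mark-to ψ p)
                ; (inʳ p) (inʳ q) → edge-to ψ p q }
  ; mark-to = λ { (inˡ p) → refl ; (inʳ p) → mark-to ψ p } }

▷-swap : ∀ a b r → rooted (a ▷ b ▷ r) ≅ rooted (b ▷ a ▷ r)
▷-swap a b r = record
  { to = swap ; from = swap ; to-from = swap-swap ; from-to = swap-swap
  ; edge-to = λ { (inˡ p) (inˡ q) → refl
                ; (inˡ p) (inʳ (inˡ q)) → trans (∧-zeroʳ (isRoot q)) (sym (∧-zeroʳ (isRoot p)))
                ; (inˡ p) (inʳ (inʳ q)) → refl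
                ; (inʳ (inˡ p)) (inˡ q) → trans (∧-zeroʳ (isRoot p)) (sym (∧-zeroʳ (isRoot q)))
                ; (inʳ (inˡ p)) (inʳ (inˡ q)) → refl
                ; (inʳ (inˡ p)) (inʳ (inʳ q)) → refl
                ; (inʳ (inʳ p)) (inˡ q) → refl
                ; (inʳ (inʳ p)) (inʳ (inˡ q)) → refl
                ; (inʳ (inʳ p)) (inʳ (inʳ q)) → refl }
  ; mark-to = λ { (inˡ p) → refl ; (inʳ (inˡ p)) → refl ; (inʳ (inʳ p)) → refl } }
  where
  swap : ∀ {a b r} → Pos (a ▷ b ▷ r) → Pos (b ▷ a ▷ r)
  swap (inˡ p)       = inʳ (inˡ p)
  swap (inʳ (inˡ p)) = inˡ p
  swap (inʳ (inʳ p)) = inʳ (inʳ p)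
  swap-swap : ∀ {a b r} (p : Pos (a ▷ b ▷ r)) → swap (swap p) ≡ p
  swap-swap (inˡ p)       = refl
  swap-swap (inʳ (inˡ p)) = refl
  swap-swap (inʳ (inʳ p)) = refl

-- Either end of the edge between the two roots can serve as the root. The map moves the root across
-- that edge, hence the statement about `free`.
▷-flip : ∀ a r → free (a ▷ r) ≅ free (r ▷ a)
▷-flip a r = record
  { to = flip ; from = flip ; to-from = flip-flip ; from-to = flip-flip
  ; edge-to = λ { (inˡ p) (inˡ q) → refl
                ; (inˡ p) (inʳ q) → ∧-comm (isRoot q) (isRoot p)
                ; (inʳ p) (inˡ q) → ∧-comm (isRoot p) (isRoot q)
                ; (inʳ p) (inʳ q) → refl }
  ; mark-to = λ _ → refl }
  where
  flip : ∀ {a r} → Pos (a ▷ r) → Pos (r ▷ a)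
  flip (inˡ p) = inʳ p
  flip (inʳ p) = inˡ p
  flip-flip : ∀ {a r} (p : Pos (a ▷ r)) → flip (flip p) ≡ p
  flip-flip (inˡ p) = refl
  flip-flip (inʳ p) = refl

size : Tree → ℕ
size •       = 1
size (a ▷ r) = size a + size r

1≤size : ∀ t → 1 ≤ size t
1≤size •       = ≤-refl
1≤size (a ▷ r) = m≤n⇒m≤n+o (size r) (1≤size a)

size-r<size-a▷r : ∀ a r → size r < size (a ▷ r)
size-r<size-a▷r a r = +-monoˡ-≤ (size r) (1≤size a)

size-a<size-a▷r : ∀ a r → size a < size (a ▷ r)
size-a<size-a▷r a r = subst (size a <_) (+-comm (size r) (size a)) (size-r<size-a▷r r a)

size≡1⇒• : ∀ t → size t ≡ 1 → t ≡ •
size≡1⇒• •       e = refl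
size≡1⇒• (a ▷ r) e = ⊥-elim (<-irrefl (sym e) (≤-<-trans (1≤size r) (size-r<size-a▷r a r)))

Pos↔Fin : ∀ t → Pos t ↔ Fin (size t)
Pos↔Fin •       = mk↔ₛ′ (λ _ → zero) (λ _ → pt) (λ { zero → refl }) (λ { pt → refl })
Pos↔Fin (a ▷ r) = ↔-trans split (↔-trans (Pos↔Fin a ⊎-↔ Pos↔Fin r) (↔-sym +↔⊎))
  where
  split : Pos (a ▷ r) ↔ (Pos a ⊎ Pos r)
  split = mk↔ₛ′ (λ { (inˡ p) → inj₁ p ; (inʳ p) → inj₂ p }) (λ { (inj₁ p) → inˡ p ; (inj₂ p) → inʳ p })
                (λ { (inj₁ p) → refl ; (inj₂ p) → refl }) (λ { (inˡ p) → refl ; (inʳ p) → refl })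

Pos-injective⇒size≤ : ∀ {s t} {f : Pos s → Pos t} → Injective _≡_ _≡_ f → size s ≤ size t
Pos-injective⇒size≤ {s} {t} inj = Fin.injective⇒≤ λ e →
  Injection.injective (↔⇒↣ (↔-sym (Pos↔Fin s))) (inj (Injection.injective (↔⇒↣ (Pos↔Fin t)) e))

-- Branches at the root

data Kid : Tree → Set where
  first : ∀ {a r} → Kid (a ▷ r)
  later : ∀ {a r} → Kid r → Kid (a ▷ r)

subtree : ∀ {t} → Kid t → Tree
subtree (first {a}) = a
subtree (later k)   = subtree k

incl : ∀ {t} (k : Kid t) → Pos (subtree k) → Pos t
incl first     p = inˡ p
incl (later k) p = inʳ (incl k p)

data PosView : ∀ {t} → Pos t → Set where
  atRoot : ∀ {t} → PosView (root t)
  below  : ∀ {t} (k : Kid t) p → PosView (incl k p)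

posView : ∀ {t} (p : Pos t) → PosView p
posView pt      = atRoot
posView (inˡ p) = below first p
posView (inʳ p) with posView p
... | atRoot    = atRoot
... | below k q = below (later k) q

inˡ-injective : ∀ {a r} {p q : Pos a} → inˡ {a} {r} p ≡ inˡ q → p ≡ q
inˡ-injective refl = refl

inʳ-injective : ∀ {a r} {p q : Pos r} → inʳ {a} {r} p ≡ inʳ q → p ≡ q
inʳ-injective refl = refl

incl-injective : ∀ {t} (k : Kid t) {p q} → incl k p ≡ incl k q → p ≡ q
incl-injective first     e = inˡ-injective e
incl-injective (later k) e = incl-injective k (inʳ-injective e)

incl-kid-injective : ∀ {t} (k l : Kid t) {p q} → incl k p ≡ incl l q → k ≡ l
incl-kid-injective first     first     e = refl
incl-kid-injective (later k) (later l) e = cong later (incl-kid-injective k l (inʳ-injective e))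

isRoot-incl : ∀ {t} (k : Kid t) p → isRoot (incl k p) ≡ false
isRoot-incl first     p = refl
isRoot-incl (later k) p = isRoot-incl k p

incl≢root : ∀ {t} (k : Kid t) {p} → incl k p ≢ root t
incl≢root {t} k {p} e with trans (sym (isRoot-incl k p)) (trans (cong isRoot e) (isRoot-root t))
... | ()

adjacent-incl : ∀ {t} (k : Kid t) p q → adjacent (incl k p) (incl k q) ≡ adjacent p q
adjacent-incl first     p q = refl
adjacent-incl (later k) p q = adjacent-incl k p q

adjacent-root-incl : ∀ {t} (k : Kid t) p → adjacent (root t) (incl k p) ≡ isRoot p
adjacent-root-incl (first {a} {r}) p = trans (cong (isRoot p ∧_) (isRoot-root r)) (∧-identityʳ _)
adjacent-root-incl (later k)       p = adjacent-root-incl k p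

adjacent⇒same-kid : ∀ {t} (k l : Kid t) p q → adjacent (incl k p) (incl l q) ≡ true → k ≡ l
adjacent⇒same-kid first     first     p q e = refl
adjacent⇒same-kid (later k) (later l) p q e = cong later (adjacent⇒same-kid k l p q e)
adjacent⇒same-kid first     (later l) p q e
  with trans (sym e) (trans (cong (isRoot p ∧_) (isRoot-incl l q)) (∧-zeroʳ _))
... | ()
adjacent⇒same-kid (later k) first     p q e
  with trans (sym e) (trans (cong (isRoot q ∧_) (isRoot-incl k p)) (∧-zeroʳ _))
... | ()

adjacent-roots : ∀ a r → adjacent (inˡ {a} {r} (root a)) (inʳ (root r)) ≡ true
adjacent-roots a r rewrite isRoot-root a | isRoot-root r = refl

-- A tree is connected, so its image cannot leave a branch without passing through the root.
image-in-branch : ∀ {s t} (f : Pos s → Pos t) →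
  (∀ p q → adjacent p q ≡ true → adjacent (f p) (f q) ≡ true) → (∀ p → f p ≢ root t) →
  Σ (Kid t) λ k → ∀ p → ∃ λ q → f p ≡ incl k q
image-in-branch {•} f hom avoid with f pt in eq | posView (f pt)
... | _ | atRoot    = ⊥-elim (avoid pt eq)
... | _ | below k q = k , λ { pt → q , eq }
image-in-branch {a ▷ r} f hom avoid
  with image-in-branch (f ∘ inˡ) (λ p q → hom _ _) (λ p → avoid _)
     | image-in-branch (f ∘ inʳ) (λ p q → hom _ _) (λ p → avoid _)
... | k , g | l , h with adjacent⇒same-kid k l _ _
  (subst₂ (λ x y → adjacent x y ≡ true) (proj₂ (g (root a))) (proj₂ (h (root r))) (hom _ _ (adjacent-roots a r)))
... | refl = k , λ { (inˡ p) → g p ; (inʳ p) → h p }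

-- Branch `k` avoids the root, so its image lies in a single branch `l`. The inverse takes `l` into
-- a single branch too, and that branch meets `k`, hence is `k`.
restrict : ∀ {s t} (φ : rooted s ≅ rooted t) (k : Kid s) → Σ (Kid t) λ l →
  Σ (rooted (subtree k) ≅ rooted (subtree l)) λ ρ → ∀ p → to φ (incl k p) ≡ incl l (to ρ p)
restrict {s} {t} φ k
  with image-in-branch (to φ ∘ incl k)
         (λ p q e → trans (edge-to φ _ _) (trans (adjacent-incl k p q) e))
         (λ p e → incl≢root k (to-injective φ (trans e (sym (to-root φ)))))
... | l , g
  with image-in-branch (from φ ∘ incl l)
         (λ p q e → trans (edge-to (≅-sym φ) _ _) (trans (adjacent-incl l p q) e))
         (λ p e → incl≢root l (to-injective (≅-sym φ) (trans e (sym (to-root (≅-sym φ))))))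
... | k′ , h
  with incl-kid-injective k k′ (trans (sym (from-to φ _))
         (trans (cong (from φ) (proj₂ (g (root _)))) (proj₂ (h _))))
... | refl = l , ρ , λ p → proj₂ (g p)
  where
  ρ : rooted (subtree k) ≅ rooted (subtree l)
  ρ = record
    { to = proj₁ ∘ g ; from = proj₁ ∘ h
    ; to-from = λ q → incl-injective l (trans (sym (proj₂ (g _)))
        (trans (cong (to φ) (sym (proj₂ (h q)))) (to-from φ _)))
    ; from-to = λ p → incl-injective k (trans (sym (proj₂ (h _)))
        (trans (cong (from φ) (sym (proj₂ (g p)))) (from-to φ _)))
    ; edge-to = λ p q → begin
        adjacent (proj₁ (g p)) (proj₁ (g q))                   ≡⟨ adjacent-incl l _ _ ⟨
        adjacent (incl l (proj₁ (g p))) (incl l (proj₁ (g q))) ≡⟨ cong₂ adjacent (proj₂ (g p)) (proj₂ (g q)) ⟨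
        adjacent (to φ (incl k p)) (to φ (incl k q))           ≡⟨ edge-to φ _ _ ⟩
        adjacent (incl k p) (incl k q)                         ≡⟨ adjacent-incl k p q ⟩
        adjacent p q                                           ∎
    -- The root of a branch is its only vertex adjacent to the root of the whole tree.
    ; mark-to = λ p → begin
        isRoot (proj₁ (g p))                       ≡⟨ adjacent-root-incl l _ ⟨
        adjacent (root t) (incl l (proj₁ (g p)))   ≡⟨ cong₂ adjacent (to-root φ) (proj₂ (g p)) ⟨
        adjacent (to φ (root s)) (to φ (incl k p)) ≡⟨ edge-to φ _ _ ⟩
        adjacent (root s) (incl k p)               ≡⟨ adjacent-root-incl k p ⟩
        isRoot p                                   ∎ }
    where open ≡-Reasoning

-- Normal forms

infix 4 _⊏_ _≺_
-- Lexicographic order on terms, used to break ties between trees of equal size.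
data _⊏_ : Tree → Tree → Set where
  •⊏  : ∀ {a r} → • ⊏ a ▷ r
  ▷⊏ˡ : ∀ {a b r s} → a ⊏ b → a ▷ r ⊏ b ▷ s
  ▷⊏ʳ : ∀ {a r s} → r ⊏ s → a ▷ r ⊏ a ▷ s

⊏-trans : ∀ {s t u} → s ⊏ t → t ⊏ u → s ⊏ u
⊏-trans •⊏      (▷⊏ˡ _) = •⊏
⊏-trans •⊏      (▷⊏ʳ _) = •⊏
⊏-trans (▷⊏ˡ x) (▷⊏ˡ y) = ▷⊏ˡ (⊏-trans x y)
⊏-trans (▷⊏ˡ x) (▷⊏ʳ y) = ▷⊏ˡ x
⊏-trans (▷⊏ʳ x) (▷⊏ˡ y) = ▷⊏ˡ y
⊏-trans (▷⊏ʳ x) (▷⊏ʳ y) = ▷⊏ʳ (⊏-trans x y)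

⊏-irrefl : ∀ {t} → ¬ t ⊏ t
⊏-irrefl (▷⊏ˡ x) = ⊏-irrefl x
⊏-irrefl (▷⊏ʳ x) = ⊏-irrefl x

⊏-connex : ∀ s t → s ⊏ t ⊎ s ≡ t ⊎ t ⊏ s
⊏-connex •       •       = inj₂ (inj₁ refl)
⊏-connex •       (b ▷ s) = inj₁ •⊏
⊏-connex (a ▷ r) •       = inj₂ (inj₂ •⊏)
⊏-connex (a ▷ r) (b ▷ s) with ⊏-connex a b | ⊏-connex r s
... | inj₁ x           | _                = inj₁ (▷⊏ˡ x)
... | inj₂ (inj₂ x)    | _                = inj₂ (inj₂ (▷⊏ˡ x))
... | inj₂ (inj₁ refl) | inj₁ y           = inj₁ (▷⊏ʳ y)
... | inj₂ (inj₁ refl) | inj₂ (inj₁ refl) = inj₂ (inj₁ refl)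
... | inj₂ (inj₁ refl) | inj₂ (inj₂ y)    = inj₂ (inj₂ (▷⊏ʳ y))

-- Size is compared first, so that deleting a leaf always moves a tree down in the order.
_≺_ : Tree → Tree → Set
s ≺ t = size s < size t ⊎ (size s ≡ size t × s ⊏ t)

≺-trans : ∀ {s t u} → s ≺ t → t ≺ u → s ≺ u
≺-trans         (inj₁ x)       (inj₁ y)       = inj₁ (<-trans x y)
≺-trans {s}     (inj₁ x)       (inj₂ (e , _)) = inj₁ (subst (size s <_) e x)
≺-trans {u = u} (inj₂ (e , _)) (inj₁ y)       = inj₁ (subst (_< size u) (sym e) y)
≺-trans         (inj₂ (e , x)) (inj₂ (f , y)) = inj₂ (trans e f , ⊏-trans x y)

≺-irrefl : ∀ {t} → ¬ t ≺ t
≺-irrefl (inj₁ x)       = <-irrefl refl x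
≺-irrefl (inj₂ (_ , x)) = ⊏-irrefl x

≺-connex : ∀ s t → s ≺ t ⊎ s ≡ t ⊎ t ≺ s
≺-connex s t with <-cmp (size s) (size t) | ⊏-connex s t
... | tri< x _ _ | _                = inj₁ (inj₁ x)
... | tri> _ _ x | _                = inj₂ (inj₂ (inj₁ x))
... | tri≈ _ e _ | inj₁ x           = inj₁ (inj₂ (e , x))
... | tri≈ _ e _ | inj₂ (inj₁ refl) = inj₂ (inj₁ refl)
... | tri≈ _ e _ | inj₂ (inj₂ x)    = inj₂ (inj₂ (inj₂ (sym e , x)))

≺⇒size≤ : ∀ {s t} → s ≺ t → size s ≤ size t
≺⇒size≤ (inj₁ x)       = <⇒≤ x
≺⇒size≤ (inj₂ (e , _)) = ≤-reflexive e

AllKids : (Tree → Set) → Tree → Set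
AllKids P t = ∀ (k : Kid t) → P (subtree k)

_∈ₖ_ : Tree → Tree → Set
x ∈ₖ t = Σ (Kid t) λ k → subtree k ≡ x

Normal : Tree → Set
Normal •       = ⊤
Normal (a ▷ r) = Normal a × Normal r × AllKids (_≺ a) r

subtree-size< : ∀ {t} (k : Kid t) → size (subtree k) < size t
subtree-size< (first {a} {r})  = size-a<size-a▷r a r
subtree-size< (later {a} {r} k) = <-trans (subtree-size< k) (size-r<size-a▷r a r)

Normal-subtree : ∀ {t} → Normal t → AllKids Normal t
Normal-subtree (na , _  , _) first     = na
Normal-subtree (_  , nr , _) (later k) = Normal-subtree nr k

subtree-injective : ∀ {t} → Normal t → (k l : Kid t) → subtree k ≡ subtree l → k ≡ l
subtree-injective n              first     first     e = refl
subtree-injective (_ , _  , max) first     (later l) e = ⊥-elim (≺-irrefl (subst (_≺ _) (sym e) (max l)))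
subtree-injective (_ , _  , max) (later k) first     e = ⊥-elim (≺-irrefl (subst (_≺ _) e (max k)))
subtree-injective (_ , nr , _)   (later k) (later l) e = cong later (subtree-injective nr k l e)

∈ₖ⇒≼-first : ∀ {a r x} → Normal (a ▷ r) → x ∈ₖ (a ▷ r) → x ≡ a ⊎ x ≺ a
∈ₖ⇒≼-first n             (first   , refl) = inj₁ refl
∈ₖ⇒≼-first (_ , _ , max) (later k , refl) = inj₂ (max k)

∈ₖ-drop : ∀ {a r s} → Normal (a ▷ r) → AllKids (_∈ₖ (a ▷ s)) (a ▷ r) → AllKids (_∈ₖ s) r
∈ₖ-drop (_ , _ , max) f k with f (later k)
... | first   , e = ⊥-elim (≺-irrefl (subst (_≺ _) (sym e) (max k)))
... | later l , e = l , e

-- Strictly descending lists with the same members agree: each head is the maximum of its list, so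
-- the heads coincide, and without them the members still agree.
Normal-ext : ∀ {s t} → Normal s → Normal t → AllKids (_∈ₖ t) s → AllKids (_∈ₖ s) t → s ≡ t
Normal-ext {•}     {•}     _ _ f g = refl
Normal-ext {•}     {b ▷ u} _ _ f g with g first
... | () , _
Normal-ext {a ▷ r} {•}     _ _ f g with f first
... | () , _
Normal-ext {a ▷ r} {b ▷ u} m n f g with ∈ₖ⇒≼-first n (f first) | ∈ₖ⇒≼-first m (g first)
... | inj₂ x    | inj₁ refl = ⊥-elim (≺-irrefl x)
... | inj₂ x    | inj₂ y    = ⊥-elim (≺-irrefl (≺-trans x y))
... | inj₁ refl | _         =
  cong (a ▷_) (Normal-ext (proj₁ (proj₂ m)) (proj₁ (proj₂ n)) (∈ₖ-drop m f) (∈ₖ-drop n g))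

-- By induction on size, an isomorphism matches each branch with an equal one, in both directions,
-- so both branch lists have the same members.
Normal-unique : ∀ {s t} → Normal s → Normal t → rooted s ≅ rooted t → s ≡ t
Normal-unique {s} {t} = unique (size s) ≤-refl
  where
  -- The bound `n` drives the recursion, since `subtree k` is not a syntactic subterm of `s`.
  unique : ∀ n {s t} → size s ≤ n → Normal s → Normal t → rooted s ≅ rooted t → s ≡ t
  unique zero    {s} s≤n = ⊥-elim (<-irrefl refl (≤-trans (1≤size s) s≤n))
  unique (suc n) {s} {t} s≤n ns nt φ = Normal-ext ns nt fwd bwd
    where
    subtree≤n : ∀ k → size (subtree {s} k) ≤ n
    subtree≤n k = ≤-pred (≤-trans (subtree-size< k) s≤n)
    fwd : AllKids (_∈ₖ t) s
    fwd k with restrict φ k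
    ... | l , ρ , _ = l , sym (unique n (subtree≤n k) (Normal-subtree ns k) (Normal-subtree nt l) ρ)
    bwd : AllKids (_∈ₖ s) t
    bwd l with restrict (≅-sym φ) l
    ... | k , ρ , _ = k , unique n (subtree≤n k) (Normal-subtree ns k) (Normal-subtree nt l) (≅-sym ρ)

-- An automorphism takes branch `k` to an isomorphic branch `l`. By uniqueness the two are equal
-- trees, by strictness they are the same branch, and induction applies inside it.
Normal-rigid : ∀ {t} → Normal t → Rigid (rooted t)
Normal-rigid {t} = rigid (size t) ≤-refl
  where
  rigid : ∀ n {t} → size t ≤ n → Normal t → Rigid (rooted t)
  rigid zero    {t} t≤n = ⊥-elim (<-irrefl refl (≤-trans (1≤size t) t≤n))
  rigid (suc n) {t} t≤n nt φ p with posView p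
  ... | atRoot    = to-root φ
  ... | below k q with restrict φ k
  ... | l , ρ , e with subtree-injective nt k l (Normal-unique (Normal-subtree nt k) (Normal-subtree nt l) ρ)
  ... | refl = trans (e q) (cong (incl k)
    (rigid n (≤-pred (≤-trans (subtree-size< k) t≤n)) (Normal-subtree nt k) ρ q))

-- Rigidity from a centroid

size-cong : ∀ {s t} → free s ≅ free t → size s ≡ size t
size-cong φ = ≤-antisym (Pos-injective⇒size≤ (to-injective φ)) (Pos-injective⇒size≤ (to-injective (≅-sym φ)))

-- Branch `k` is brought to the front by transpositions; `y` is its complement, which contains the
-- root.
pull : ∀ {t} (k : Kid t) → Σ Tree λ y → Σ (rooted t ≅ rooted (subtree k ▷ y)) λ π →
  ∀ p → to π (incl k p) ≡ inˡ p
pull (first {a} {r}) = r , ≅-refl , λ _ → refl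
pull (later {a} k) with pull k
... | y , π , e = a ▷ y , ≅-trans (▷-cong ≅-refl π) (▷-swap a (subtree k) y)
                , λ p → cong (to (▷-swap a (subtree k) y) ∘ inʳ) (e p)

image-in-branch⇒size≤ : ∀ {s t} (f : Pos s → Pos t) → Injective _≡_ _≡_ f →
  (k : Kid t) → (∀ p → ∃ λ q → f p ≡ incl k q) → size s ≤ size (subtree k)
image-in-branch⇒size≤ f inj k g = Pos-injective⇒size≤ {f = proj₁ ∘ g} λ {p} {q} e →
  inj (trans (proj₂ (g p)) (trans (cong (incl k) e) (sym (proj₂ (g q)))))

-- The complement of the branch k containing φ (root t) is pulled back by φ to a connected set
-- avoiding the root, that is, into a single branch.
moved-root⇒size≤ : ∀ {t} (φ : free t ≅ free t) (k : Kid t) p → to φ (root t) ≡ incl k p →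
  Σ (Kid t) λ l → size t ≤ size (subtree k) + size (subtree l)
moved-root⇒size≤ {t} φ k p e with pull k
... | y , π , π-incl = proj₁ branch , (begin
    size t                                      ≡⟨ size-cong (unroot π) ⟩
    size (subtree k) + size y                   ≤⟨ +-monoʳ-≤ _ (image-in-branch⇒size≤ f f-injective _ (proj₂ branch)) ⟩
    size (subtree k) + size (subtree (proj₁ branch)) ∎)
  where
  open ≤-Reasoning
  θ : free (subtree k ▷ y) ≅ free t
  θ = ≅-trans (≅-sym (unroot π)) (≅-sym φ)
  f : Pos y → Pos t
  f = to θ ∘ inʳ
  f-injective : Injective _≡_ _≡_ f
  f-injective = inʳ-injective ∘ to-injective θ
  f-avoids : ∀ q → f q ≢ root t
  -- The vertex that `θ` sends to the root is `inˡ p`, which lies in branch `k` and not in its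
  -- complement.
  f-avoids q e′ with to-injective θ (trans e′ (sym (trans (cong (from φ ∘ from π) (sym (π-incl p)))
    (trans (cong (from φ) (trans (from-to π _) (sym e))) (from-to φ _)))))
  ... | ()
  branch = image-in-branch f (λ p q → trans (edge-to θ _ _)) f-avoids

SizeAtMost : ℕ → Tree → Set
SizeAtMost m x = size x ≤ m

-- The root is the only centroid: an automorphism moving it would bound the size of the tree by that
-- of two branches, hence by `m + m`.
centroid-rigid : ∀ {t} m → m + m < size t → Normal t → AllKids (SizeAtMost m) t → Rigid (free t)
centroid-rigid {t} m 2m<t nt small φ with to φ (root t) in eq | posView (to φ (root t))
... | _ | atRoot    = Normal-rigid nt (enroot φ eq)
... | _ | below k p with moved-root⇒size≤ φ k p eq
... | l , t≤ = ⊥-elim (<-irrefl refl (<-≤-trans 2m<t (≤-trans t≤ (+-mono-≤ (small k) (small l)))))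

larger-▷-Normal : ∀ {a r} → size r ≤ size a → Normal a → Normal r → Normal (a ▷ r)
larger-▷-Normal r≤a na nr = na , nr , λ k → inj₁ (<-≤-trans (subtree-size< k) r≤a)

-- The edge between the two roots cuts the tree into equal halves. Counting shows that an
-- automorphism fixes the root or exchanges the halves; an exchange would make `a` and `r`
-- isomorphic as rooted trees, hence equal.
bicentroid-rigid : ∀ {a r} → size a ≡ size r → Normal a → Normal r → a ≢ r → Rigid (free (a ▷ r))
bicentroid-rigid {a} {r} a≡r na nr a≢r φ with to φ (inʳ (root r)) in eq | posView (to φ (inʳ (root r)))
... | _ | atRoot          = Normal-rigid (larger-▷-Normal (≤-reflexive (sym a≡r)) na nr) (enroot φ eq)
... | _ | below (later k) p = ⊥-elim (too-large (moved-root⇒size≤ φ (later k) p eq))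
  where
  kid≤ : (l : Kid (a ▷ r)) → size (subtree l) ≤ size a
  kid≤ first     = ≤-refl
  kid≤ (later l) = <⇒≤ (subst (size (subtree l) <_) (sym a≡r) (subtree-size< l))
  too-large : ¬ Σ (Kid (a ▷ r)) λ l → size (a ▷ r) ≤ size (subtree k) + size (subtree l)
  too-large (l , le) = <-irrefl refl (<-≤-trans (+-mono-<-≤ (subtree-size< k) (kid≤ l))
    (subst (_≤ size (subtree k) + size (subtree l)) (+-comm (size a) (size r)) le))
... | _ | below first p   = ⊥-elim (a≢r (sym (Normal-unique nr na (enroot swapped (isRoot⇒≡root _ root-to-root)))))
  where
  ψ = ≅-sym φ
  inʳ≢inˡ : ∀ {p : Pos a} {q : Pos r} → inʳ q ≢ inˡ p
  inʳ≢inˡ ()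
  r→a : ∀ q → ∃ λ p → to ψ (inʳ q) ≡ inˡ p
  r→a with image-in-branch (to ψ ∘ inʳ) (λ p q → trans (edge-to ψ _ _))
             (λ q e → inʳ≢inˡ (to-injective ψ (trans e (sym (trans (cong (from φ) (sym eq)) (from-to φ _))))))
  ... | first   , g = g
  ... | later l , g = ⊥-elim (<-irrefl refl (≤-<-trans
    (image-in-branch⇒size≤ _ (inʳ-injective ∘ to-injective ψ) (later l) g) (subtree-size< l)))
  a→r : ∀ p → ∃ λ q → to ψ (inˡ p) ≡ inʳ q
  a→r p with to ψ (inˡ p) in e
  ... | inʳ q = q , refl
  -- Otherwise all of `r` and one further vertex would be mapped injectively into `a`.
  ... | inˡ p′ = ⊥-elim (<-irrefl (sym a≡r) (Pos-injective⇒size≤ {• ▷ r} {a} {f} inj))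
    where
    f : Pos (• ▷ r) → Pos a
    f (inˡ _) = p′
    f (inʳ q) = proj₁ (r→a q)
    p′≢ : ∀ q → p′ ≢ proj₁ (r→a q)
    p′≢ q e′ = inʳ≢inˡ (to-injective ψ (trans (proj₂ (r→a q)) (trans (cong inˡ (sym e′)) (sym e))))
    inj : Injective _≡_ _≡_ f
    inj {inˡ pt} {inˡ pt} _ = refl
    inj {inˡ pt} {inʳ q} e′ = ⊥-elim (p′≢ q e′)
    inj {inʳ q} {inˡ pt} e′ = ⊥-elim (p′≢ q (sym e′))
    inj {inʳ q} {inʳ q′} e′ = cong inʳ (inʳ-injective (to-injective ψ
      (trans (proj₂ (r→a q)) (trans (cong inˡ e′) (sym (proj₂ (r→a q′)))))))
  a→r′ : ∀ p → ∃ λ q → to φ (inˡ p) ≡ inʳ q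
  a→r′ p with to φ (inˡ p) in e
  ... | inʳ q  = q , refl
  ... | inˡ p′ = ⊥-elim (inʳ≢inˡ (trans (sym (proj₂ (a→r p′))) (trans (cong (from φ) (sym e)) (from-to φ _))))
  swapped : free r ≅ free a
  swapped = record
    { to = proj₁ ∘ r→a ; from = proj₁ ∘ a→r′
    ; to-from = λ p → inˡ-injective (trans (sym (proj₂ (r→a _)))
        (trans (cong (from φ) (sym (proj₂ (a→r′ p)))) (from-to φ _)))
    ; from-to = λ q → inʳ-injective (trans (sym (proj₂ (a→r′ _)))
        (trans (cong (to φ) (sym (proj₂ (r→a q)))) (to-from φ _)))
    ; edge-to = λ p q → trans (sym (cong₂ adjacent (proj₂ (r→a p)) (proj₂ (r→a q)))) (edge-to ψ (inʳ p) (inʳ q))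
    ; mark-to = λ _ → refl }
  -- The only edge between the halves joins their roots, so preserving it matches the roots.
  root-to-root : isRoot (proj₁ (r→a (root r))) ≡ true
  root-to-root
    with isRoot (proj₁ (r→a (root r)))
       | trans (sym (cong₂ adjacent (proj₂ (a→r (root a))) (proj₂ (r→a (root r)))))
                                (trans (edge-to ψ (inˡ (root a)) (inʳ (root r))) (adjacent-roots a r))
  ... | true | _ = refl

-- Normalisation

-- One step of insertion sort. Stating `all-kids` for every property lets it carry over both order
-- bounds and size bounds on the branches.
record Insertion (x r : Tree) : Set₁ where
  field
    result   : Tree
    normal   : Normal result
    iso      : rooted (x ▷ r) ≅ rooted result
    all-kids : ∀ {P} → P x → AllKids P r → AllKids P result

insert : ∀ x r → Normal x → Normal r → x ∈ₖ r ⊎ Insertion x r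
insert x •       nx nr = inj₂ record
  { result = x ▷ • ; normal = nx , tt , λ () ; iso = ≅-refl ; all-kids = λ { px _ first → px } }
insert x (b ▷ r) nx (nb , nr , max) with ≺-connex b x
... | inj₂ (inj₁ refl) = inj₁ (first , refl)
... | inj₁ b≺x         = inj₂ record
  { result = x ▷ b ▷ r
  ; normal = nx , (nb , nr , max) , λ { first → b≺x ; (later k) → ≺-trans (max k) b≺x }
  ; iso = ≅-refl
  ; all-kids = λ { px all first → px ; px all (later k) → all k } }
... | inj₂ (inj₂ x≺b) with insert x r nx nr
... | inj₁ (k , e)     = inj₁ (later k , e)
... | inj₂ ins         = inj₂ record
  { result = b ▷ result
  ; normal = nb , normal , all-kids x≺b max
  ; iso = ≅-trans (▷-swap x b r) (▷-cong ≅-refl iso)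
  ; all-kids = λ { px all first → all first ; px all (later k) → all-kids px (all ∘ later) k } }
  where open Insertion ins

-- Once the second copy is pulled to the front of `r`, exchanging the two copies is a nontrivial
-- automorphism.
repeated-kid⇒¬rigid : ∀ {x r} → x ∈ₖ r → ¬ Rigid (rooted (x ▷ r))
repeated-kid⇒¬rigid (k , refl) rigid with pull k
... | y , π , _ with Rigid-resp-≅ (▷-cong ≅-refl π) rigid (▷-swap _ _ y) (inˡ (root (subtree k)))
... | ()

insert-rigid : ∀ x r → Normal x → Normal r → Rigid (rooted (x ▷ r)) → Insertion x r
insert-rigid x r nx nr rigid with insert x r nx nr
... | inj₁ x∈r = ⊥-elim (repeated-kid⇒¬rigid x∈r rigid)
... | inj₂ ins = ins

-- Automorphisms of either part extend by the identity, so both parts are rigid. Rigidity of the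
-- whole then excludes a repeated branch during sorting.
normalise : ∀ t → Rigid (rooted t) → Σ Tree λ s → Normal s × rooted t ≅ rooted s
normalise •       rigid = • , tt , ≅-refl
normalise (a ▷ r) rigid
  with normalise a (λ φ p → inˡ-injective (rigid (▷-cong φ ≅-refl) (inˡ p)))
     | normalise r (λ φ p → inʳ-injective (rigid (▷-cong ≅-refl φ) (inʳ p)))
... | a′ , na , φ | r′ , nr , ψ =
  result , normal , ≅-trans (▷-cong φ ψ) iso
  where open Insertion (insert-rigid a′ r′ na nr (Rigid-resp-≅ (▷-cong φ ψ) rigid))

-- The rest contains the root and `heaviest` is a largest branch, so `balanced` says that no branch
-- exceeds half of the tree: the root is a centroid.
record Centred (t : Tree) : Set where
  constructor centred
  field
    {heaviest} : Tree
    {rest}     : Tree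
    normal     : Normal (heaviest ▷ rest)
    iso        : free t ≅ free (heaviest ▷ rest)
    balanced   : size heaviest ≤ size rest

-- If the heaviest branch outweighs the rest, the root moves into it. The new branches are `r` and
-- those of `a`, all smaller than `a`, so the bound `n` drops.
centre-normal : ∀ n a r → size a ≤ n → Normal (a ▷ r) → Rigid (free (a ▷ r)) → Centred (a ▷ r)
centre-normal zero    a r a≤n nt rigid = ⊥-elim (<-irrefl refl (≤-trans (1≤size a) a≤n))
centre-normal (suc n) a r a≤n nt@(na , nr , max) rigid with size a ≤? size r
... | yes a≤r = centred nt ≅-refl a≤r
... | no  a≰r = rerooted result normal iso (all-kids r≤n λ k → ≤-pred (≤-trans (subtree-size< k) a≤n))
  where
  r≤n : size r ≤ n
  r≤n = ≤-pred (≤-trans (≰⇒> a≰r) a≤n)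
  open Insertion (insert-rigid r a nr na (free-rigid⇒rooted-rigid (Rigid-resp-≅ (▷-flip a r) rigid)))
  rerooted : ∀ s → Normal s → rooted (r ▷ a) ≅ rooted s → AllKids (SizeAtMost n) s → Centred (a ▷ r)
  rerooted •       ns φ small = ⊥-elim (<-irrefl refl (<-≤-trans (≤-<-trans (1≤size a) (size-r<size-a▷r r a))
                                                               (≤-reflexive (size-cong (unroot φ)))))
  rerooted (b ▷ u) ns φ small = centred (Centred.normal c) (≅-trans ψ (Centred.iso c)) (Centred.balanced c)
    where
    ψ : free (a ▷ r) ≅ free (b ▷ u)
    ψ = ≅-trans (▷-flip a r) (unroot φ)
    c = centre-normal n b u (small first) ns (Rigid-resp-≅ ψ rigid)

centre : ∀ t → 2 ≤ size t → Rigid (free t) → Centred t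
centre t 2≤t rigid with normalise t (free-rigid⇒rooted-rigid rigid)
... | •     , ns , φ = ⊥-elim (<-irrefl refl (≤-trans 2≤t (≤-reflexive (size-cong (unroot φ)))))
... | a ▷ r , ns , φ = centred (Centred.normal c) (≅-trans (unroot φ) (Centred.iso c)) (Centred.balanced c)
  where c = centre-normal (size a) a r ≤-refl ns (Rigid-resp-≅ (unroot φ) rigid)

-- Adding and removing leaves

-- The new leaf becomes the last branch at its neighbour. On terms, deleting a leaf is expressed in
-- reverse, by a smaller tree and a point of attachment.
ins : ∀ {t} → Pos t → Tree
ins pt              = • ▷ •
ins {a ▷ r} (inˡ p) = ins p ▷ r
ins {a ▷ r} (inʳ p) = a ▷ ins p

-- Always descends into the last branch, a lightest one in a normal tree, so the branches stay distinct;
-- prune • = • is a junk value.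
prune : Tree → Tree
prune •               = •
prune (a ▷ b ▷ r)     = a ▷ prune (b ▷ r)
prune (• ▷ •)         = •
prune ((a ▷ b) ▷ •)   = prune (a ▷ b) ▷ •

ins-prune : ∀ a r → Σ (Pos (prune (a ▷ r))) λ p → ins p ≡ a ▷ r
ins-prune a       (b ▷ r) with ins-prune b r
... | p , e = inʳ p , cong (a ▷_) e
ins-prune •       •       = pt , refl
ins-prune (a ▷ b) •       with ins-prune a b
... | p , e = inˡ p , cong (_▷ •) e

size-ins : ∀ {t} (p : Pos t) → size (ins p) ≡ suc (size t)
size-ins pt              = refl
size-ins {a ▷ r} (inˡ p) = cong (_+ size r) (size-ins p)
size-ins {a ▷ r} (inʳ p) = trans (cong (size a +_) (size-ins p)) (+-suc (size a) (size r))

size-prune : ∀ a r → suc (size (prune (a ▷ r))) ≡ size (a ▷ r)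
size-prune a r with ins-prune a r
... | p , e = trans (sym (size-ins p)) (cong size e)

size-prune≤ : ∀ t → size (prune t) ≤ size t
size-prune≤ •       = ≤-refl
size-prune≤ (a ▷ r) = <⇒≤ (≤-reflexive (size-prune a r))

prune-≺ : ∀ {c} t → t ≺ c → prune t ≺ c
prune-≺ •       t≺c = t≺c
prune-≺ (a ▷ r) t≺c = ≺-trans (inj₁ (≤-reflexive (size-prune a r))) t≺c

prune-AllKids : ∀ {P : Tree → Set} → (∀ x → P x → P (prune x)) → ∀ t → AllKids P t → AllKids P (prune t)
prune-AllKids P-prune •             all k         = all k
prune-AllKids P-prune (a ▷ b ▷ r)   all first     = all first
prune-AllKids P-prune (a ▷ b ▷ r)   all (later k) = prune-AllKids P-prune (b ▷ r) (all ∘ later) k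
prune-AllKids P-prune (• ▷ •)       all ()
prune-AllKids P-prune ((a ▷ b) ▷ •) all first     = P-prune (a ▷ b) (all first)

prune-Normal : ∀ t → Normal t → Normal (prune t)
prune-Normal •             _               = tt
prune-Normal (a ▷ b ▷ r)   (na , nr , max) = na , prune-Normal (b ▷ r) nr , prune-AllKids prune-≺ (b ▷ r) max
prune-Normal (• ▷ •)       _               = tt
prune-Normal ((a ▷ b) ▷ •) (na , _ , _)    = prune-Normal (a ▷ b) na , tt , λ ()

▷-injectiveˡ : ∀ {a b r s} → a ▷ r ≡ b ▷ s → a ≡ b
▷-injectiveˡ refl = refl

-- Unless both trees are `•`, the equations force each to have a single branch, and these two
-- branches satisfy the same equations: infinite descent.
prune-▷•-swap : ∀ x y → x ≡ prune (y ▷ •) → y ≡ prune (x ▷ •) → x ≡ y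
prune-▷•-swap •           •           _ _ = refl
prune-▷•-swap (x ▷ •)     (y ▷ •)     e f =
  cong (_▷ •) (prune-▷•-swap x y (▷-injectiveˡ e) (▷-injectiveˡ f))

_≟ᵗ_ : ∀ s t → Dec (s ≡ t)
s ≟ᵗ t with ⊏-connex s t
... | inj₁ s⊏t        = no λ { refl → ⊏-irrefl s⊏t }
... | inj₂ (inj₁ e)   = yes e
... | inj₂ (inj₂ t⊏s) = no λ { refl → ⊏-irrefl t⊏s }

-- One step of the reduction

-- `P₂` and `P₃` are paths rooted at an end. The final `•` of `E₇ᵗ` is the vertex of degree three;
-- the legs of lengths 3, 2, 1 are its branches.
P₂ P₃ E₇ᵗ : Tree
P₂  = • ▷ •
P₃  = P₂ ▷ •
E₇ᵗ = P₃ ▷ P₂ ▷ • ▷ •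

record Reduction (t : Tree) : Set where
  constructor reduction
  field
    {smaller} : Tree
    pos       : Pos smaller
    2≤size    : 2 ≤ size smaller
    rigid     : Rigid (free smaller)
    iso       : free t ≅ free (ins pos)

2≤size-▷ : ∀ a r → 2 ≤ size (a ▷ r)
2≤size-▷ a r = +-mono-≤ (1≤size a) (1≤size r)

≡⇒≅ : ∀ {s t} → s ≡ t → free s ≅ free t
≡⇒≅ refl = ≅-refl

rigid⇒halves≢ : ∀ {a r} → Rigid (free (a ▷ r)) → a ≢ r
rigid⇒halves≢ {a} rigid refl with rigid (▷-flip a a) (inˡ (root a))
... | ()

size-▷• : ∀ x → size (x ▷ •) ≡ suc (size x)
size-▷• x = +-comm (size x) 1

-- The pruned branch need not be the largest any more and is inserted anew. The bounds make the root
-- the only centroid, so the one obstruction is an equal branch in `r`.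
prune-in-first : ∀ m a b r → Normal (a ▷ b) → Normal r →
  size (prune (a ▷ b)) ≤ m → AllKids (SizeAtMost m) r → m + m < size (prune (a ▷ b)) + size r →
  prune (a ▷ b) ∈ₖ r ⊎ Reduction ((a ▷ b) ▷ r)
prune-in-first m a b r na nr d≤m kids≤m 2m<t with insert (prune (a ▷ b)) r (prune-Normal (a ▷ b) na) nr
... | inj₁ repeated = inj₁ repeated
... | inj₂ inserted = inj₂ (reduction (inˡ (proj₁ (ins-prune a b))) (2≤size-▷ (prune (a ▷ b)) r)
  (Rigid-resp-≅ (≅-sym (unroot iso))
    (centroid-rigid m (subst (m + m <_) (size-cong (unroot iso)) 2m<t) normal (all-kids {SizeAtMost m} d≤m kids≤m)))
  (≡⇒≅ (cong (_▷ r) (sym (proj₂ (ins-prune a b))))))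
  where open Insertion inserted

sole-kid : ∀ {t} (k : Kid t) → suc (size (subtree k)) ≡ size t → t ≡ subtree k ▷ •
sole-kid (first {a} {r})   e =
  cong (a ▷_) (size≡1⇒• r (+-cancelˡ-≡ (size a) _ _ (trans (sym e) (sym (size-▷• a)))))
sole-kid (later {a} {r} k) e = ⊥-elim (<-irrefl e (≤-<-trans (subtree-size< k) (size-r<size-a▷r a r)))

-- If `c` is first, `y` and `z` share two vertices. A later `c` would miss the root and all of `x`,
-- which has at least two vertices because `y ≺ x`.
kid-with-• : ∀ {x y z c} → Normal (x ▷ y ▷ z) → c ∈ₖ (x ▷ y ▷ z) →
  2 + size c ≡ size (x ▷ y ▷ z) → x ▷ y ▷ z ≡ c ▷ • ▷ •
kid-with-• {x} {y} {z} n (first , refl) e = cong₂ (λ y z → x ▷ y ▷ z) (size≡1⇒• y 1≡y) (size≡1⇒• z 1≡z)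
  where
  yz≡2 : size y + size z ≡ 2
  yz≡2 = +-cancelˡ-≡ (size x) _ _ (trans (sym e) (+-comm 2 (size x)))
  1≡y : size y ≡ 1
  1≡y = ≤-antisym (+-cancelʳ-≤ 1 _ _ (≤-trans (+-monoʳ-≤ (size y) (1≤size z)) (≤-reflexive yz≡2))) (1≤size y)
  1≡z : size z ≡ 1
  1≡z = ≤-antisym (+-cancelˡ-≤ 1 _ _ (≤-trans (+-monoˡ-≤ (size z) (1≤size y)) (≤-reflexive yz≡2))) (1≤size z)
kid-with-• {x} {y} {z} (_ , _ , max) (later k , refl) e with max first
... | y≺x = ⊥-elim (impossible k e)
  where
  1<x : 1 < size x
  1<x with size x in eq
  ... | suc (suc _) = s≤s (s≤s z≤n)
  ... | suc zero with size≡1⇒• x eq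
  ... | refl = ⊥-elim (≺-irrefl (subst (_≺ •) (size≡1⇒• y (≤-antisym (≺⇒size≤ y≺x) (1≤size y))) y≺x))
  1<x | zero = ⊥-elim (<-irrefl (sym eq) (1≤size x))
  impossible : ∀ k → 2 + size (subtree {y ▷ z} k) ≢ size (x ▷ y ▷ z)
  impossible k e = <-irrefl e (<-≤-trans (s≤s (s≤s (subtree-size< k))) (+-monoˡ-≤ (size (y ▷ z)) 1<x))

-- As `r` has a branch, `prune` spares `a` and leaves more than `size a` vertices outside it.
reduce-far : ∀ {a r} → Normal (a ▷ r) → 2 + size a ≤ size r → Reduction (a ▷ r)
reduce-far {a} {•}     nt (s≤s ())
reduce-far {a} {b ▷ r} nt a+2≤r with ins-prune b r
... | p , e = reduction (inʳ p) (2≤size-▷ a (prune (b ▷ r)))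
  (centroid-rigid (size a) (+-monoʳ-< (size a) (≤-pred (≤-trans a+2≤r (≤-reflexive (sym (size-prune b r))))))
    (prune-Normal (a ▷ b ▷ r) nt)
    (prune-AllKids (λ x x≤a → ≤-trans (size-prune≤ x) x≤a) (a ▷ b ▷ r)
      λ { first → ≤-refl ; (later k) → ≺⇒size≤ (proj₂ (proj₂ nt) k) }))
  (≡⇒≅ (cong (a ▷_) (sym e)))

-- Pruning the first half makes the root of `r` the only centroid. A repeated branch has one vertex
-- less than `r`, so it is all of `r` but the root.
prune-in-half : ∀ a b r → Normal (a ▷ b) → Normal r → size (a ▷ b) ≡ size r →
  r ≡ prune ((a ▷ b) ▷ •) ⊎ Reduction ((a ▷ b) ▷ r)
prune-in-half a b r na nr eq
  with prune-in-first (size (prune (a ▷ b))) a b r na nr ≤-refl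
         (λ k → ≤-pred (≤-trans (subtree-size< k) (≤-reflexive d+1≡r)))
         (+-monoʳ-< (size (prune (a ▷ b))) (≤-reflexive (sym d+1≡r)))
  where
  d+1≡r : size r ≡ suc (size (prune (a ▷ b)))
  d+1≡r = trans (sym eq) (sym (size-prune a b))
... | inj₂ reduced = inj₂ reduced
... | inj₁ (k , e) = inj₁ (trans (sole-kid k (trans (cong (suc ∘ size) e) (trans (size-prune a b) eq))) (cong (_▷ •) e))

Reduction-resp-≅ : ∀ {s t} → free s ≅ free t → Reduction t → Reduction s
Reduction-resp-≅ φ (reduction p 2≤ rigid iso) = reduction p 2≤ rigid (≅-trans φ iso)

reduce-halves : ∀ {a r} → Normal (a ▷ r) → Rigid (free (a ▷ r)) → size a ≡ size r → Reduction (a ▷ r)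
reduce-halves {•} {r} nt rigid eq = ⊥-elim (rigid⇒halves≢ rigid (sym (size≡1⇒• r (sym eq))))
reduce-halves {a ▷ b} {•} nt rigid eq = ⊥-elim (rigid⇒halves≢ rigid (size≡1⇒• (a ▷ b) eq))
reduce-halves {a ▷ b} {c ▷ d} (na , nr , _) rigid eq
  with prune-in-half a b (c ▷ d) na nr eq | prune-in-half c d (a ▷ b) nr na (sym eq)
... | inj₂ reduced | _            = reduced
... | inj₁ _       | inj₂ reduced = Reduction-resp-≅ (▷-flip _ _) reduced
... | inj₁ e       | inj₁ f       = ⊥-elim (rigid⇒halves≢ rigid (prune-▷•-swap (a ▷ b) (c ▷ d) f e))

-- Pruning `a` or `x` leaves two equal halves: the other branch, and the pruned one together with
-- the root. If both choices gave equal trees, descent would yield `a = x`, against strictness.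
reduce-hinge : ∀ {a x} → Normal (a ▷ x ▷ •) → size a ≡ size x → Reduction (a ▷ x ▷ •)
reduce-hinge {•} {x} (_ , _ , max) eq = ⊥-elim (≺-irrefl (subst (_≺ •) (size≡1⇒• x (sym eq)) (max first)))
reduce-hinge {a ▷ b} {•} (_ , _ , max) eq = ⊥-elim (≺-irrefl (subst (• ≺_) (size≡1⇒• (a ▷ b) eq) (max first)))
reduce-hinge {a ▷ b} {c ▷ d} (na , (nx , _) , max) eq
  with (c ▷ d) ≟ᵗ prune ((a ▷ b) ▷ •) | (a ▷ b) ≟ᵗ prune ((c ▷ d) ▷ •)
... | yes e | yes f = ⊥-elim (≺-irrefl (subst (_≺ (a ▷ b)) (prune-▷•-swap (c ▷ d) (a ▷ b) e f) (max first)))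
... | no x≢ | _     = reduction (inˡ (proj₁ (ins-prune a b))) (2≤size-▷ (prune (a ▷ b)) ((c ▷ d) ▷ •))
  -- Swapping the branches displays the tree as its two halves.
  (Rigid-resp-≅ (unroot (▷-swap (c ▷ d) (prune (a ▷ b)) •))
    (bicentroid-rigid (trans (sym eq) (trans (sym (size-prune a b)) (sym (size-▷• (prune (a ▷ b))))))
      nx (prune-Normal (a ▷ b) na , tt , λ ()) x≢))
  (≡⇒≅ (cong (_▷ (c ▷ d) ▷ •) (sym (proj₂ (ins-prune a b)))))
... | yes _ | no a≢ = reduction (inʳ (inˡ (proj₁ (ins-prune c d)))) (2≤size-▷ (a ▷ b) (prune (c ▷ d) ▷ •))
  (bicentroid-rigid (trans eq (trans (sym (size-prune c d)) (sym (size-▷• (prune (c ▷ d))))))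
    na (prune-Normal (c ▷ d) nx , tt , λ ()) a≢)
  (≡⇒≅ (cong (λ x → (a ▷ b) ▷ x ▷ •) (sym (proj₂ (ins-prune c d)))))

-- After the deletion the halves differ, as one root has a single branch and the other has two. The
-- size bound keeps the pruned branch distinct from its sibling `•`.
reduce-spider : ∀ u v → Normal (u ▷ v) → 2 ≤ size (prune (u ▷ v)) →
  Reduction (((u ▷ v) ▷ •) ▷ (u ▷ v) ▷ • ▷ •)
reduce-spider u v n 2≤d = reduction (inʳ (inˡ (proj₁ (ins-prune u v))))
  (2≤size-▷ ((u ▷ v) ▷ •) (prune (u ▷ v) ▷ • ▷ •))
  (bicentroid-rigid (trans (size-▷• (u ▷ v)) (trans (cong suc (sym (size-prune u v))) (+-comm 2 (size (prune (u ▷ v))))))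
    (n , tt , λ ()) (prune-Normal (u ▷ v) n , (tt , tt , λ ()) , λ { first → inj₁ 2≤d ; (later ()) }) λ ())
  (≡⇒≅ (cong (λ x → ((u ▷ v) ▷ •) ▷ x ▷ • ▷ •) (sym (proj₂ (ins-prune u v)))))

-- If `x` has two vertices, the tree is `E₇ᵗ`. Otherwise the shape of `x` is split until `prune`
-- computes to a tree with visibly at least two vertices.
reduce-near-path : ∀ x → Normal x → • ≺ x → let t = (x ▷ •) ▷ x ▷ • ▷ • in t ≡ E₇ᵗ ⊎ Reduction t
reduce-near-path •                   _ •≺x = ⊥-elim (≺-irrefl •≺x)
reduce-near-path (• ▷ •)             _ _   = inj₁ refl
reduce-near-path (• ▷ v@(_ ▷ _))     n _   = inj₂ (reduce-spider • v n (2≤size-▷ • (prune v)))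
reduce-near-path (u@(_ ▷ _) ▷ •)     n _   = inj₂ (reduce-spider u • n (2≤size-▷ (prune u) •))
reduce-near-path (u@(_ ▷ _) ▷ v@(_ ▷ _)) n _ = inj₂ (reduce-spider u v n (2≤size-▷ u (prune v)))

reduce-twig : ∀ {a x} → Normal (a ▷ x ▷ • ▷ •) → size a ≡ suc (size x) →
  let t = a ▷ x ▷ • ▷ • in t ≡ E₇ᵗ ⊎ Reduction t
reduce-twig {a} {x} (na , (nx , _ , max) , _) eq with a ≟ᵗ (x ▷ •)
... | yes refl = reduce-near-path x nx (max first)
-- The position is the root of `a ▷ x ▷ •`: the last branch `•` is deleted, leaving the halves `a`
-- and `x ▷ •`.
... | no a≢    = inj₂ (reduction (inʳ (inʳ pt)) (2≤size-▷ a (x ▷ •))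
  (bicentroid-rigid (trans eq (sym (size-▷• x))) na (nx , tt , λ ()) a≢) ≅-refl)

reduce-near : ∀ {a r} → Normal (a ▷ r) → suc (size a) ≡ size r → a ▷ r ≡ E₇ᵗ ⊎ Reduction (a ▷ r)
reduce-near {a} {•}     nt eq = ⊥-elim (<-irrefl (sym (suc-injective eq)) (1≤size a))
reduce-near {a} {x ▷ •} nt eq = inj₂ (reduce-hinge nt (suc-injective (trans eq (size-▷• x))))
reduce-near {•} {x ▷ y ▷ z} nt eq = ⊥-elim (<-irrefl eq (+-mono-≤ (1≤size x) (2≤size-▷ y z)))
reduce-near {a ▷ b} {x ▷ y ▷ z} nt@(na , nr@(nx , _ , max) , _) eq
  with prune-in-first (size d) a b (x ▷ y ▷ z) na nr ≤-refl kids≤d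
    (+-monoʳ-< (size d) (≤-trans (n≤1+n _) (≤-reflexive d+2≡r)))
  where
  d = prune (a ▷ b)
  d+2≡r : 2 + size d ≡ size (x ▷ y ▷ z)
  d+2≡r = trans (cong suc (size-prune a b)) eq
  x≤d : size x ≤ size d
  -- Of the `2 + size d` vertices, `y ▷ z` takes at least two.
  x≤d = +-cancelʳ-≤ 2 _ _ (≤-trans (+-monoʳ-≤ (size x) (2≤size-▷ y z))
    (≤-reflexive (trans (sym d+2≡r) (+-comm 2 (size d)))))
  kids≤d : AllKids (SizeAtMost (size d)) (x ▷ y ▷ z)
  kids≤d first     = x≤d
  kids≤d (later k) = ≤-trans (≺⇒size≤ (max k)) x≤d
... | inj₂ reduced = inj₂ reduced
-- The repeated branch misses exactly two vertices of `x ▷ y ▷ z`, which is therefore `d ▷ • ▷ •`.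
... | inj₁ repeated with kid-with-• nr repeated (trans (cong suc (size-prune a b)) eq)
... | refl = reduce-twig nt (sym (size-prune a b))

reduce : ∀ t → 2 ≤ size t → Rigid (free t) → free t ≅ free E₇ᵗ ⊎ Reduction t
reduce t 2≤t rigid = transport (by-balance (m≤n⇒m<n∨m≡n balanced))
  where
  open Centred (centre t 2≤t rigid)
  by-balance : size heaviest < size rest ⊎ size heaviest ≡ size rest →
    heaviest ▷ rest ≡ E₇ᵗ ⊎ Reduction (heaviest ▷ rest)
  by-balance (inj₂ eq) = inj₂ (reduce-halves normal (Rigid-resp-≅ iso rigid) eq)
  by-balance (inj₁ lt) with m≤n⇒m<n∨m≡n lt
  ... | inj₁ far = inj₂ (reduce-far normal far)
  ... | inj₂ eq  = reduce-near normal eq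
  transport : heaviest ▷ rest ≡ E₇ᵗ ⊎ Reduction (heaviest ▷ rest) → free t ≅ free E₇ᵗ ⊎ Reduction t
  transport (inj₁ e) = inj₁ (≅-trans iso (≡⇒≅ e))
  transport (inj₂ r) = inj₂ (Reduction-resp-≅ iso r)

-- Leaves as new vertices

-- `nothing` is the new vertex and the marks are its neighbours. With arbitrary marks, this also
-- undoes the deletion of any vertex of a graph.
addLeaf : MarkedGraph → MarkedGraph
addLeaf H = record { Vertex = Maybe (Vertex H) ; edge = edge′ ; mark = λ _ → false }
  where
  edge′ : Maybe (Vertex H) → Maybe (Vertex H) → Bool
  edge′ nothing  nothing  = false
  edge′ nothing  (just y) = mark H y
  edge′ (just x) nothing  = mark H x
  edge′ (just x) (just y) = edge H x y

addLeaf-cong : ∀ {H K} → H ≅ K → addLeaf H ≅ addLeaf K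
addLeaf-cong φ = record
  { to = Maybe.map (to φ) ; from = Maybe.map (from φ)
  ; to-from = λ { nothing → refl ; (just y) → cong just (to-from φ y) }
  ; from-to = λ { nothing → refl ; (just x) → cong just (from-to φ x) }
  ; edge-to = λ { nothing nothing → refl ; nothing (just y) → mark-to φ y
                ; (just x) nothing → mark-to φ x ; (just x) (just y) → edge-to φ x y }
  ; mark-to = λ _ → refl }

samePos : ∀ {t} → Pos t → Pos t → Bool
samePos pt      pt      = true
samePos (inˡ p) (inˡ q) = samePos p q
samePos (inˡ p) (inʳ q) = false
samePos (inʳ p) (inˡ q) = false
samePos (inʳ p) (inʳ q) = samePos p q

samePos-refl : ∀ {t} (p : Pos t) → samePos p p ≡ true
samePos-refl pt      = refl
samePos-refl (inˡ p) = samePos-refl p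
samePos-refl (inʳ p) = samePos-refl p

samePos⇒≡ : ∀ {t} (p q : Pos t) → samePos p q ≡ true → p ≡ q
samePos⇒≡ pt      pt      e = refl
samePos⇒≡ (inˡ p) (inˡ q) e = cong inˡ (samePos⇒≡ p q e)
samePos⇒≡ (inʳ p) (inʳ q) e = cong inʳ (samePos⇒≡ p q e)

markedAt : ∀ {t} → Pos t → MarkedGraph
markedAt {t} p = record { Vertex = Pos t ; edge = adjacent ; mark = samePos p }

adjacent-sym : ∀ {t} (p q : Pos t) → adjacent p q ≡ adjacent q p
adjacent-sym pt      pt      = refl
adjacent-sym (inˡ p) (inˡ q) = adjacent-sym p q
adjacent-sym (inˡ p) (inʳ q) = refl
adjacent-sym (inʳ p) (inˡ q) = refl
adjacent-sym (inʳ p) (inʳ q) = adjacent-sym p q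

adjacent-irrefl : ∀ {t} (p : Pos t) → adjacent p p ≡ false
adjacent-irrefl pt      = refl
adjacent-irrefl (inˡ p) = adjacent-irrefl p
adjacent-irrefl (inʳ p) = adjacent-irrefl p

new : ∀ {t} (p : Pos t) → Pos (ins p)
new pt      = inˡ pt
new (inˡ p) = inˡ (new p)
new (inʳ p) = inʳ (new p)

old : ∀ {t} (p : Pos t) → Pos t → Pos (ins p)
old pt      pt      = inʳ pt
old (inˡ p) (inˡ q) = inˡ (old p q)
old (inˡ p) (inʳ q) = inʳ q
old (inʳ p) (inˡ q) = inˡ q
old (inʳ p) (inʳ q) = inʳ (old p q)

strip : ∀ {t} (p : Pos t) → Pos (ins p) → Maybe (Pos t)
strip pt      (inˡ _) = nothing
strip pt      (inʳ _) = just pt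
strip (inˡ p) (inˡ x) = Maybe.map inˡ (strip p x)
strip (inˡ p) (inʳ q) = just (inʳ q)
strip (inʳ p) (inˡ q) = just (inˡ q)
strip (inʳ p) (inʳ x) = Maybe.map inʳ (strip p x)

strip-new : ∀ {t} (p : Pos t) → strip p (new p) ≡ nothing
strip-new pt      = refl
strip-new (inˡ p) = cong (Maybe.map inˡ) (strip-new p)
strip-new (inʳ p) = cong (Maybe.map inʳ) (strip-new p)

strip-old : ∀ {t} (p q : Pos t) → strip p (old p q) ≡ just q
strip-old pt      pt      = refl
strip-old (inˡ p) (inˡ q) = cong (Maybe.map inˡ) (strip-old p q)
strip-old (inˡ p) (inʳ q) = refl
strip-old (inʳ p) (inˡ q) = refl
strip-old (inʳ p) (inʳ q) = cong (Maybe.map inʳ) (strip-old p q)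

unstrip : ∀ {t} (p : Pos t) → Maybe (Pos t) → Pos (ins p)
unstrip p nothing  = new p
unstrip p (just q) = old p q

unstrip-strip : ∀ {t} (p : Pos t) x → unstrip p (strip p x) ≡ x
unstrip-strip pt      (inˡ pt) = refl
unstrip-strip pt      (inʳ pt) = refl
unstrip-strip (inˡ p) (inˡ x) with strip p x | unstrip-strip p x
... | nothing | e = cong inˡ e
... | just _  | e = cong inˡ e
unstrip-strip (inˡ p) (inʳ q) = refl
unstrip-strip (inʳ p) (inˡ q) = refl
unstrip-strip (inʳ p) (inʳ x) with strip p x | unstrip-strip p x
... | nothing | e = cong inʳ e
... | just _  | e = cong inʳ e

isRoot-new : ∀ {t} (p : Pos t) → isRoot (new p) ≡ false
isRoot-new pt      = refl
isRoot-new (inˡ p) = refl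
isRoot-new (inʳ p) = isRoot-new p

isRoot-old : ∀ {t} (p q : Pos t) → isRoot (old p q) ≡ isRoot q
isRoot-old pt      pt      = refl
isRoot-old (inˡ p) (inˡ q) = refl
isRoot-old (inˡ p) (inʳ q) = refl
isRoot-old (inʳ p) (inˡ q) = refl
isRoot-old (inʳ p) (inʳ q) = isRoot-old p q

adjacent-old : ∀ {t} (p q r : Pos t) → adjacent (old p q) (old p r) ≡ adjacent q r
adjacent-old pt      pt      pt      = refl
adjacent-old (inˡ p) (inˡ q) (inˡ r) = adjacent-old p q r
adjacent-old (inˡ p) (inˡ q) (inʳ r) = cong (_∧ isRoot r) (isRoot-old p q)
adjacent-old (inˡ p) (inʳ q) (inˡ r) = cong (_∧ isRoot q) (isRoot-old p r)
adjacent-old (inˡ p) (inʳ q) (inʳ r) = refl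
adjacent-old (inʳ p) (inˡ q) (inˡ r) = refl
adjacent-old (inʳ p) (inˡ q) (inʳ r) = cong (isRoot q ∧_) (isRoot-old p r)
adjacent-old (inʳ p) (inʳ q) (inˡ r) = cong (isRoot r ∧_) (isRoot-old p q)
adjacent-old (inʳ p) (inʳ q) (inʳ r) = adjacent-old p q r

adjacent-new-old : ∀ {t} (p q : Pos t) → adjacent (new p) (old p q) ≡ samePos p q
adjacent-new-old pt      pt      = refl
adjacent-new-old (inˡ p) (inˡ q) = adjacent-new-old p q
adjacent-new-old (inˡ p) (inʳ q) = cong (_∧ isRoot q) (isRoot-new p)
adjacent-new-old (inʳ p) (inˡ q) = trans (cong (isRoot q ∧_) (isRoot-new p)) (∧-zeroʳ _)
adjacent-new-old (inʳ p) (inʳ q) = adjacent-new-old p q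

addLeaf-ins : ∀ {t} (p : Pos t) → addLeaf (markedAt p) ≅ free (ins p)
addLeaf-ins p = record
  { to = unstrip p ; from = strip p ; to-from = unstrip-strip p
  ; from-to = λ { nothing → strip-new p ; (just q) → strip-old p q }
  ; edge-to = λ { nothing nothing → adjacent-irrefl (new p) ; nothing (just q) → adjacent-new-old p q
                ; (just q) nothing → trans (adjacent-sym (old p q) (new p)) (adjacent-new-old p q)
                ; (just q) (just r) → adjacent-old p q r }
  ; mark-to = λ _ → refl }

-- Graphs on Fin n

fromGraph : ∀ {n} → Graph n → MarkedGraph
fromGraph {n} G = record { Vertex = Fin n ; edge = adj G ; mark = λ _ → false }

neighboursMarked : ∀ {n} → Graph (suc n) → Fin (suc n) → MarkedGraph
neighboursMarked {n} G v = record
  { Vertex = Fin n ; edge = adj (delete G v) ; mark = λ i → adj G v (punchIn v i) }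

addLeaf-delete : ∀ {n} (G : Graph (suc n)) v → addLeaf (neighboursMarked G v) ≅ fromGraph G
addLeaf-delete {n} G v = record
  { to = put ; from = take ; to-from = put-take ; from-to = take-put
  ; edge-to = λ { nothing nothing → irrefl G v ; nothing (just i) → refl
                ; (just i) nothing → Graph.sym G _ v ; (just i) (just j) → refl }
  ; mark-to = λ _ → refl }
  where
  put : Maybe (Fin n) → Fin (suc n)
  put nothing  = v
  put (just i) = punchIn v i
  take : Fin (suc n) → Maybe (Fin n)
  take x with v Fin.≟ x
  ... | yes _  = nothing
  ... | no v≢x = just (punchOut v≢x)
  put-take : ∀ x → put (take x) ≡ x
  put-take x with v Fin.≟ x
  ... | yes e  = e
  ... | no v≢x = Fin.punchIn-punchOut v≢x
  take-put : ∀ m → take (put m) ≡ m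
  take-put nothing with v Fin.≟ v
  ... | yes _  = refl
  ... | no v≢v = ⊥-elim (v≢v refl)
  take-put (just i) with v Fin.≟ punchIn v i
  ... | yes e  = ⊥-elim (Fin.punchInᵢ≢i v i (sym e))
  ... | no v≢x = cong just (Fin.punchIn-injective v _ _ (Fin.punchIn-punchOut v≢x))

-- Reading off a leaf deletion from a tree with an attached leaf

module _ {n t} (G : Graph (suc n)) (p : Pos t) (χ : fromGraph G ≅ addLeaf (markedAt p)) where

  leafVertex : Fin (suc n)
  leafVertex = from χ nothing

  leafVertex-Leaf : Leaf G leafVertex
  leafVertex-Leaf = from χ (just p) , trans (edge-to (≅-sym χ) _ _) (samePos-refl p) , unique
    where
    unique : ∀ w → Adj G leafVertex w → w ≡ from χ (just p)
    unique w a
      with to χ w in e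
         | trans (sym (trans (edge-to χ _ w) a))
             (cong (λ x → edge (addLeaf (markedAt p)) x (to χ w)) (to-from χ nothing))
    ... | nothing | ()
    ... | just q  | s with samePos⇒≡ p q (sym s)
    ... | refl = trans (sym (from-to χ w)) (cong (from χ) e)

  delete-leafVertex : fromGraph (delete G leafVertex) ≅ free t
  delete-leafVertex = record
    { to = proj₁ ∘ f ; from = g
    ; to-from = λ q → just-injective (trans (sym (proj₂ (f (g q))))
        (trans (cong (to χ) (Fin.punchIn-punchOut (v≢ q))) (to-from χ _)))
    ; from-to = λ i → Fin.punchIn-injective leafVertex _ _ (trans (Fin.punchIn-punchOut (v≢ _))
        (trans (cong (from χ) (sym (proj₂ (f i)))) (from-to χ _)))
    ; edge-to = λ i j → trans (sym (cong₂ (edge (addLeaf (markedAt p))) (proj₂ (f i)) (proj₂ (f j)))) (edge-to χ _ _)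
    ; mark-to = λ _ → refl }
    where
    f : ∀ i → ∃ λ q → to χ (punchIn leafVertex i) ≡ just q
    f i with to χ (punchIn leafVertex i) in e
    ... | just q  = q , refl
    ... | nothing = ⊥-elim (Fin.punchInᵢ≢i leafVertex i (trans (sym (from-to χ _)) (cong (from χ) e)))
    v≢ : ∀ q → leafVertex ≢ from χ (just q)
    v≢ q e with to-injective (≅-sym χ) e
    ... | ()
    g : Pos t → Fin n
    g q = punchOut (v≢ q)

-- Finding a leaf by extending a path

module _ {n} (G : Graph n) where

  -- `vertex` is defined on all naturals and constrained below `k`, which makes extension at the
  -- front a mere shift.
  record Path (k : ℕ) : Set where
    field
      vertex   : ℕ → Fin n
      distinct : ∀ {i j} → i < k → j < k → vertex i ≡ vertex j → i ≡ j
      consec   : ∀ {i} → suc i < k → Adj G (vertex i) (vertex (suc i))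
  open Path

  Path⇒≤ : ∀ {k} → Path k → k ≤ n
  Path⇒≤ π = Fin.injective⇒≤ {f = vertex π ∘ toℕ} λ {i} {j} e →
    Fin.toℕ-injective (distinct π (Fin.toℕ<n i) (Fin.toℕ<n j) e)

  edgePath : ∀ {x y} → Adj G x y → Path 2
  edgePath {x} {y} a = record
    { vertex = xy ; distinct = xy-distinct ; consec = λ { {zero} _ → a ; {suc _} (s≤s (s≤s ())) } }
    where
    xy : ℕ → Fin n
    xy zero    = x
    xy (suc _) = y
    x≢y : x ≢ y
    x≢y refl with trans (sym a) (irrefl G x)
    ... | ()
    xy-distinct : ∀ {i j} → i < 2 → j < 2 → xy i ≡ xy j → i ≡ j
    xy-distinct {zero}        {zero}        _ _ e = refl
    xy-distinct {zero}        {suc _}       _ _ e = ⊥-elim (x≢y e)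
    xy-distinct {suc _}       {zero}        _ _ e = ⊥-elim (x≢y (sym e))
    xy-distinct {suc zero}    {suc zero}    _ _ e = refl
    xy-distinct {suc (suc _)} (s≤s (s≤s ()))
    xy-distinct {_} {suc (suc _)} _ (s≤s (s≤s ()))

  extend : ∀ {k} (π : Path (suc k)) w → Adj G w (vertex π 0) →
    (∀ {i} → i < suc k → vertex π i ≢ w) → Path (suc (suc k))
  extend {k} π w a fresh = record
    { vertex = vs ; distinct = vs-distinct ; consec = λ { {zero} _ → a ; {suc _} (s≤s lt) → consec π lt } }
    where
    vs : ℕ → Fin n
    vs zero    = w
    vs (suc i) = vertex π i
    vs-distinct : ∀ {i j} → i < suc (suc k) → j < suc (suc k) → vs i ≡ vs j → i ≡ j
    vs-distinct {zero}  {zero}  _        _        e = refl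
    vs-distinct {zero}  {suc _} _        (s≤s lt) e = ⊥-elim (fresh lt (sym e))
    vs-distinct {suc _} {zero}  (s≤s lt) _        e = ⊥-elim (fresh lt e)
    vs-distinct {suc _} {suc _} (s≤s p)  (s≤s q)  e = cong suc (distinct π p q e)

  last-tabulate : ∀ {m} (f : Fin (suc m) → Fin n) → Vec.last (Vec.tabulate f) ≡ f (fromℕ m)
  last-tabulate {zero}  f = refl
  last-tabulate {suc m} f = last-tabulate (f ∘ suc)

  closePath : ∀ {k} (π : Path k) j → 2 + j < k → Adj G (vertex π (2 + j)) (vertex π 0) → Cycle G
  closePath {k} π j j<k a = record
    { len = j ; verts = vs
    ; distinct = λ a b e → Fin.toℕ-injective (distinct π (below-k a) (below-k b)
        (trans (sym (lookup-vs a)) (trans e (lookup-vs b))))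
    ; consec = λ a → subst₂ (Adj G) (sym (trans (lookup-vs (inject₁ a)) (cong (vertex π) (Fin.toℕ-inject₁ a))))
        (sym (lookup-vs (suc a))) (consec π (below-k (suc a)))
    ; closing = subst (λ x → Adj G x (vertex π 0))
        (sym (trans (last-tabulate (vertex π ∘ toℕ)) (cong (vertex π) (Fin.toℕ-fromℕ (2 + j))))) a }
    where
    vs : Vec.Vec (Fin n) (3 + j)
    vs = Vec.tabulate (vertex π ∘ toℕ)
    lookup-vs : ∀ a → Vec.lookup vs a ≡ vertex π (toℕ a)
    lookup-vs = lookup∘tabulate (vertex π ∘ toℕ)
    below-k : (a : Fin (3 + j)) → toℕ a < k
    below-k a = <-≤-trans (Fin.toℕ<n a) j<k

  -- A path that cannot be extended at its start ends there in a leaf.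
  findLeaf-from : Acyclic G → ∀ f k → n ≤ f + (2 + k) → Path (2 + k) → ∃ λ v → Leaf G v
  findLeaf-from acyclic f k n≤ π
    with Fin.any? (λ w → (adj G (vertex π 0) w Bool.≟ true) ×-dec ¬? (w Fin.≟ vertex π 1))
  ... | no none = vertex π 0 , vertex π 1 , consec π (s≤s (s≤s z≤n))
                , λ w a → decidable-stable (w Fin.≟ vertex π 1) λ w≢ → none (w , a , w≢)
  -- If `w` is on the path, it is at position 0, giving a loop, at position 1, excluded by its
  -- choice, or later, closing a cycle.
  ... | yes (w , a , w≢y) with Fin.any? (λ (i : Fin (2 + k)) → vertex π (toℕ i) Fin.≟ w)
  ... | yes (zero , refl)        = ⊥-elim (false≢true (trans (sym (irrefl G _)) a))
    where
    false≢true : false ≢ true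
    false≢true ()
  ... | yes (suc zero , e)       = ⊥-elim (w≢y (sym e))
  ... | yes (suc (suc i) , refl) = ⊥-elim (acyclic (closePath π (toℕ i) (s≤s (s≤s (Fin.toℕ<n i)))
                                             (trans (Graph.sym G _ _) a)))
  ... | no fresh = continue f n≤
    where
    π′ : Path (3 + k)
    π′ = extend π w (trans (Graph.sym G _ _) a) λ i<k e →
      fresh (fromℕ< i<k , trans (cong (vertex π) (Fin.toℕ-fromℕ< i<k)) e)
    continue : ∀ f → n ≤ f + (2 + k) → ∃ λ v → Leaf G v
    -- The extended path would have more than `n` distinct vertices.
    continue zero    n≤ = ⊥-elim (<-irrefl refl (≤-trans (Path⇒≤ π′) n≤))
    continue (suc f) n≤ = findLeaf-from acyclic f (suc k) (≤-trans n≤ (≤-reflexive (sym (+-suc f (2 + k))))) π′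

findLeaf : ∀ {n} (G : Graph (2 + n)) → IsTree G → ∃ λ v → Leaf G v
findLeaf {n} G (_ , connected , acyclic) with connected zero (suc zero)
... | step a _ = findLeaf-from G acyclic (2 + n) 0 (m≤m+n (2 + n) 2) (edgePath G a)

-- Trees are closed under deleting leaves

module _ {n} (G : Graph (2 + n)) {v} (leaf : Leaf G v) where

  private
    u = proj₁ leaf
    v≢u : v ≢ u
    v≢u refl with trans (sym (proj₁ (proj₂ leaf))) (irrefl G v)
    ... | ()

    -- Folding the leaf onto its neighbour collapses the edge between them and keeps all others, so
    -- walks survive the deletion.
    retract : Fin (2 + n) → Fin (1 + n)
    retract x with v Fin.≟ x
    ... | yes _  = punchOut v≢u
    ... | no v≢x = punchOut v≢x

    retract-punchIn : ∀ i → retract (punchIn v i) ≡ i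
    retract-punchIn i with v Fin.≟ punchIn v i
    ... | yes e  = ⊥-elim (Fin.punchInᵢ≢i v i (sym e))
    ... | no v≢x = Fin.punchIn-injective v _ _ (Fin.punchIn-punchOut v≢x)

    retract-step : ∀ {i j} → Adj G i j → retract i ≡ retract j ⊎ Adj (delete G v) (retract i) (retract j)
    retract-step {i} {j} a with v Fin.≟ i | v Fin.≟ j
    ... | yes refl | yes refl = inj₁ refl
    ... | yes refl | no v≢j   = inj₁ (Fin.punchOut-cong v (sym (proj₂ (proj₂ leaf) j a)))
    ... | no v≢i   | yes refl = inj₁ (Fin.punchOut-cong v (proj₂ (proj₂ leaf) i (trans (Graph.sym G v i) a)))
    ... | no v≢i   | no v≢j   = inj₂ (subst₂ (Adj G) (sym (Fin.punchIn-punchOut v≢i)) (sym (Fin.punchIn-punchOut v≢j)) a)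

    retract-Reach : ∀ {i j} → Reach G i j → Reach (delete G v) (retract i) (retract j)
    retract-Reach here = here
    retract-Reach (step a r) with retract-step a
    ... | inj₁ e = subst (λ x → Reach (delete G v) x _) (sym e) (retract-Reach r)
    ... | inj₂ b = step b (retract-Reach r)

    last-map : ∀ {m} (xs : Vec.Vec (Fin (1 + n)) (suc m)) →
      Vec.last (Vec.map (punchIn v) xs) ≡ punchIn v (Vec.last xs)
    last-map (x Vec.∷ Vec.[])         = refl
    last-map (x Vec.∷ xs@(_ Vec.∷ _)) = last-map xs

    embed-Cycle : Cycle (delete G v) → Cycle G
    embed-Cycle c = record
      { len = Cycle.len c ; verts = Vec.map (punchIn v) vs
      ; distinct = λ a b e → Cycle.distinct c a b (Fin.punchIn-injective v _ _
          (trans (sym (lookup-map a (punchIn v) vs)) (trans e (lookup-map b (punchIn v) vs))))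
      ; consec = λ a → subst₂ (Adj G) (sym (lookup-map (inject₁ a) (punchIn v) vs))
          (sym (lookup-map (suc a) (punchIn v) vs)) (Cycle.consec c a)
      ; closing = closing′ vs (Cycle.closing c) }
      where
      vs = Cycle.verts c
      closing′ : ∀ {m} (xs : Vec.Vec (Fin (1 + n)) (suc m)) → Adj (delete G v) (Vec.last xs) (Vec.head xs) →
        Adj G (Vec.last (Vec.map (punchIn v) xs)) (Vec.head (Vec.map (punchIn v) xs))
      closing′ xs@(x Vec.∷ _) a = subst (λ z → Adj G z (punchIn v x)) (sym (last-map xs)) a

  delete-leaf-IsTree : IsTree G → IsTree (delete G v)
  delete-leaf-IsTree (_ , connected , acyclic) = s≤s z≤n
    , (λ i j → subst₂ (Reach (delete G v)) (retract-punchIn i) (retract-punchIn j)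
                 (retract-Reach (connected (punchIn v i) (punchIn v j))))
    , acyclic ∘ embed-Cycle

-- By induction, the graph without a leaf is realised by a term, and the leaf is attached again at
-- the image of its neighbour.
realise : ∀ n (G : Graph (suc n)) → IsTree G → Σ Tree λ t → fromGraph G ≅ free t
realise zero    G _    = • , record
  { to = λ _ → pt ; from = λ _ → zero ; to-from = λ { pt → refl } ; from-to = λ { zero → refl }
  ; edge-to = λ { zero zero → sym (irrefl G zero) } ; mark-to = λ _ → refl }
realise (suc n) G tree with findLeaf G tree
... | v , leaf@(u , v~u , only-u) with realise n (delete G v) (delete-leaf-IsTree G leaf tree)
... | t , φ = ins p , ≅-trans (≅-sym (addLeaf-delete G v)) (≅-trans (addLeaf-cong marked) (addLeaf-ins p))
  where
  v≢u : v ≢ u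
  v≢u refl with trans (sym v~u) (irrefl G v)
  ... | ()
  u′ = punchOut v≢u
  p = to φ u′
  mark-φ : ∀ i → samePos p (to φ i) ≡ adj G v (punchIn v i)
  mark-φ i = ⇔→≡ (mk⇔
    (λ e → subst (Adj G v) (trans (sym (Fin.punchIn-punchOut v≢u))
      (cong (punchIn v) (to-injective φ (samePos⇒≡ p (to φ i) e)))) v~u)
    (λ a → subst (λ j → samePos p (to φ j) ≡ true)
      (Fin.punchIn-injective v u′ i (trans (Fin.punchIn-punchOut v≢u) (sym (only-u _ a)))) (samePos-refl p)))
  marked : neighboursMarked G v ≅ markedAt p
  marked = record
    { to = to φ ; from = from φ ; to-from = to-from φ ; from-to = from-to φ
    ; edge-to = edge-to φ ; mark-to = mark-φ }

AutFree⇒Rigid : ∀ {n} (G : Graph n) → AutFree G → Rigid (fromGraph G)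
AutFree⇒Rigid G (_ , trivial) φ = trivial (mk↔ₛ′ (to φ) (from φ) (to-from φ) (from-to φ) , edge-to φ)

Rigid⇒AutFree : ∀ {n} (G : Graph n) → 2 ≤ n → Rigid (fromGraph G) → AutFree G
Rigid⇒AutFree G 2≤n rigid = 2≤n , λ (f , pres) → rigid record
  { to = Inverse.to f ; from = Inverse.from f
  ; to-from = Inverse.strictlyInverseˡ f ; from-to = Inverse.strictlyInverseʳ f
  ; edge-to = pres ; mark-to = λ _ → refl }

order≡size : ∀ {n t} (G : Graph n) → fromGraph G ≅ free t → n ≡ size t
order≡size {t = t} G φ = ↔⇒≡ (↔-trans (mk↔ₛ′ (to φ) (from φ) (to-from φ) (from-to φ)) (Pos↔Fin t))

E7≅E₇ᵗ : fromGraph E7 ≅ free E₇ᵗ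
E7≅E₇ᵗ = record
  { to = at ; from = index ; to-from = at-index
  ; from-to = from-yes (Fin.all? λ i → index (at i) Fin.≟ i)
  ; edge-to = from-yes (Fin.all? λ i → Fin.all? λ j → adjacent (at i) (at j) Bool.≟ e7adj i j)
  ; mark-to = λ _ → refl }
  where
  at : Fin 7 → Pos E₇ᵗ
  -- The entries follow the numbering of `E7`: the centre, then the legs of lengths 1, 2, 3, each
  -- outwards.
  at = Vec.lookup (inʳ (inʳ (inʳ pt)) Vec.∷ inʳ (inʳ (inˡ pt))
    Vec.∷ inʳ (inˡ (inʳ pt)) Vec.∷ inʳ (inˡ (inˡ pt))
    Vec.∷ inˡ (inʳ pt) Vec.∷ inˡ (inˡ (inʳ pt)) Vec.∷ inˡ (inˡ (inˡ pt)) Vec.∷ Vec.[])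
  index : Pos E₇ᵗ → Fin 7
  index (inʳ (inʳ (inʳ pt))) = # 0
  index (inʳ (inʳ (inˡ pt))) = # 1
  index (inʳ (inˡ (inʳ pt))) = # 2
  index (inʳ (inˡ (inˡ pt))) = # 3
  index (inˡ (inʳ pt))       = # 4
  index (inˡ (inˡ (inʳ pt))) = # 5
  index (inˡ (inˡ (inˡ pt))) = # 6
  at-index : ∀ p → at (index p) ≡ p
  at-index (inʳ (inʳ (inʳ pt))) = refl
  at-index (inʳ (inʳ (inˡ pt))) = refl
  at-index (inʳ (inˡ (inʳ pt))) = refl
  at-index (inʳ (inˡ (inˡ pt))) = refl
  at-index (inˡ (inʳ pt))       = refl
  at-index (inˡ (inˡ (inʳ pt))) = refl
  at-index (inˡ (inˡ (inˡ pt))) = refl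

-- Induction on the number of vertices. The graph is tracked up to isomorphism with a term, because
-- `delete` renumbers the vertices at every step.
dismantle : ∀ n (T : Graph n) t → fromGraph T ≅ free t → 2 ≤ size t → Rigid (free t) →
  Σ (Graph 7) λ H → (T ⇝ H) × Isomorphic H E7
dismantle n T t φ 2≤t rigid with reduce t 2≤t rigid
-- The isomorphism forces `n` to be 7, so `T` itself ends the sequence.
... | inj₁ ψ with order≡size T (≅-trans φ ψ)
... | refl = T , done , (mk↔ₛ′ (to θ) (from θ) (to-from θ) (from-to θ) , edge-to θ)
  where
  θ : fromGraph T ≅ fromGraph E7
  θ = ≅-trans φ (≅-trans ψ (≅-sym E7≅E₇ᵗ))
dismantle zero    T t φ 2≤t rigid | inj₂ _ = ⊥-elim (<-irrefl (order≡size T φ) (≤-trans (s≤s z≤n) 2≤t))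
dismantle (suc n) T t φ 2≤t rigid | inj₂ (reduction {s} p 2≤s rigid-s ψ) =
  let (H , steps , H≅E7) = dismantle n (delete T (leafVertex T p χ)) s φ′ 2≤s rigid-s
  in H , del (leafVertex T p χ) (leafVertex-Leaf T p χ) autFree steps , H≅E7
  where
  χ : fromGraph T ≅ addLeaf (markedAt p)
  χ = ≅-trans φ (≅-trans ψ (≅-sym (addLeaf-ins p)))
  φ′ : fromGraph (delete T (leafVertex T p χ)) ≅ free s
  φ′ = delete-leafVertex T p χ
  T′ = delete T (leafVertex T p χ)
  autFree : AutFree T′
  autFree = Rigid⇒AutFree T′ (subst (2 ≤_) (sym (order≡size T′ φ′)) 2≤s)
    (Rigid-resp-≅ (≅-sym φ′) rigid-s)

theorem1p3 : ∀ (n : ℕ) (T : Graph n) → IsTree T → AutFree T →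
    Σ (Graph 7) λ H → (T ⇝ H) × Isomorphic H E7
theorem1p3 zero    T (() , _) autFree
theorem1p3 (suc n) T tree autFree@(2≤n , _) with realise n T tree
... | t , φ = dismantle (suc n) T t φ (subst (2 ≤_) (order≡size T φ) 2≤n) (Rigid-resp-≅ φ (AutFree⇒Rigid T autFree))
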